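{- Let $p$ be an odd prime, $1\le m<n$, $\bar B\subseteq[n]\setminus[m]$ with $|\bar B|=b\ge1$. Let $I$ be the unsaturated generalized order ideal of $\mathbb{GH}(m,n)$ in which every element of $[m]\cup\bar B$ has multiplicity $p-1$ and all other elements have multiplicity $0$, and let $D=\mathbb{F}_p^n\setminus I(\mathbb{GP})$ (unsaturated notion). Write $u=(v,w)$ with $v\in\mathbb{F}_p^m$, $w\in\mathbb{F}_p^{n-m}$, $k=\mathrm{wt}(v)$, and $\delta=1$ if the restriction of $w$ to the coordinates in $\bar B$ is zero, $\delta=0$ otherwise. Put $c_1=p^{n-m-b}$, $c_0=p^{n-m}-p^{n-m-b}$ and $T_k=(-1)^k(p-1)^{m-k}$. If $(m,b)\ne(1,n-1)$, then $|D|=p^n-p^m-(p-1)^m(p^b-1)$, $\dim\mathcal{C}_D=n$, and for every $u\neq0$ \[ \mathrm{wt}(c_D(u))=\frac{p-1}{p}\Big(|D|+p^m[k=0]+T_k(p^b\delta-1)\Big), \] where the number of nonzero $u$ with given $(k,\delta)$ is $\binom mk(p-1)^kc_\delta$, minus one for $(k,\delta)=(0,1)$. The code has at most $2(m+1)$ nonzero weights. For $m=1$ and $b\le n-2$ it is a three-weight code of length $p^n-(p-1)p^b-1$ with weights $(p-1)p^{n-1}-(p-1)^2p^{b-1}$, $(p-1)(p^{n-1}-p^b)$, $(p-1)p^{n-1}$. In the excluded case $(m,b)=(1,n-1)$ one has $D=\{0\}\times(\mathbb{F}_p^{n-1}\setminus0)$, the map $u\mapsto c_D(u)$ has kernel $\mathbb{F}_pe_1$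 (with $e_1$ the first standard basis vector), and $\mathcal{C}_D$ is a one-weight $[p^{n-1}-1,\ n-1,\ (p-1)p^{n-2}]$ code.
   Context: $[n]=\{1,\dots,n\}$; $[\,\cdot\,]$ applied to a condition is $1$ if it holds and $0$ otherwise; $\mathrm{wt}$ is Hamming weight. For $D\subseteq\mathbb{F}_p^n$, $\mathcal{C}_D=\{c_D(u)=(u\cdot x)_{x\in D}:u\in\mathbb{F}_p^n\}$, where $u\cdot x=\sum_i u_ix_i$. An $[N,k,d]$ code is a linear code over $\mathbb{F}_p$ of length $N$, dimension $k$, minimum distance $d$; an $s$-weight code has exactly $s$ distinct nonzero weights. Generalized order ideals: $[n]_{p-1}$ is the multiset in which each $i\in[n]$ has multiplicity $p-1$. A sub-multiset $J$ is identified with its multiplicity vector $(J_1,\dots,J_n)\in\{0,\dots,p-1\}^n=\mathbb{F}_p^n$; $J\subseteq J'$ means $J_i\le J'_i$ (as integers) for all $i$; $\bar J=\{i:J_i\ne0\}$. The hierarchical poset $\mathbb{H}(m,n)$ on $[n]$ has as its only strict relations $i\prec j$ for all $i\in[m]$, $j\in[n]\setminus[m]$; $\mathbb{GH}(m,n)$ denotes $[n]_{p-1}$ together with this order. $J$ is an unsaturated generalized order ideal if $\bar J$ is an order ideal (down-closed subset) of $\mathbb{H}(m,n)$. For an unsaturated generalized order ideal $I$, $I(\mathbb{GP})\subseteq\mathbb{F}_p^n$ is the set of all unsaturated generalized order ideals contained in $I$. -}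

module Defs where

open import Data.Bool.Base using (true; false; if_then_else_; not)
open import Data.Fin.Base as Fin using (Fin; toℕ)
import Data.Fin.Properties as Fin
open import Data.Fin.Subset using (Subset; _∈_; _∉_; _∪_)
open import Data.Fin.Subset.Properties using (_∈?_; x∈p∪q⁺)
open import Data.List.Base as List using (List; []; _∷_; length; filter; cartesianProductWith)
import Data.List.Membership.Propositional as List
import Data.List.Membership.Propositional.Properties as List
open import Data.List.Relation.Unary.Any using (here)
open import Data.List.Relation.Unary.All using ([])
open import Data.List.Relation.Unary.AllPairs using ([]; _∷_)
open import Data.List.Relation.Unary.Unique.Propositional using (Unique)
import Data.List.Relation.Unary.Unique.Propositional.Properties as Unique
open import Data.Nat.Base as ℕ using (ℕ; zero; suc; NonZero; _∸_; _≤_; _<_; s≤s)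
open import Data.Nat.DivMod using (_mod_; m<n⇒m%n≡m)
import Data.Nat.Properties as ℕ
open import Data.Product using (∃; _×_; _,_)
open import Data.Sum.Base using (inj₁)
open import Data.Vec.Base as Vec using (Vec; []; _∷_; lookup; _[_]≔_)
import Data.Vec.Properties as Vec
open import Data.Vec.Relation.Binary.Pointwise.Inductive as Pointwise using (Pointwise)
open import Data.Vec.Relation.Unary.All using (All)
open import Function using (_∘_; _⇔_)
open import Level using (0ℓ)
open import Relation.Binary.Core using (Rel)
open import Relation.Binary.PropositionalEquality using (_≡_; _≢_; refl; sym; trans; cong; subst)
open import Relation.Nullary using (Dec; yes; no; does; ¬?; _×-dec_; _→-dec_; contradiction)
open import Relation.Unary using (Pred; Decidable; ∁)
open import Relation.Unary.Properties using (∁?)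

private variable
  p n N : ℕ

𝔽 : ℕ → Set
𝔽 p = Fin p

0# 1# : .{{_ : NonZero p}} → 𝔽 p
0# {p} = 0 mod p
1# {p} = 1 mod p

infixl 6 _+ᶠ_ _+ᵛ_
infixl 7 _*ᶠ_ _*ᵛ_ _∙_

_+ᶠ_ _*ᶠ_ : .{{_ : NonZero p}} → 𝔽 p → 𝔽 p → 𝔽 p
_+ᶠ_ {p} x y = (toℕ x ℕ.+ toℕ y) mod p
_*ᶠ_ {p} x y = (toℕ x ℕ.* toℕ y) mod p

0ᵛ : .{{_ : NonZero p}} → Vec (𝔽 p) n
0ᵛ {n = n} = Vec.replicate n 0#

_+ᵛ_ : .{{_ : NonZero p}} → Vec (𝔽 p) n → Vec (𝔽 p) n → Vec (𝔽 p) n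
_+ᵛ_ = Vec.zipWith _+ᶠ_

_*ᵛ_ : .{{_ : NonZero p}} → 𝔽 p → Vec (𝔽 p) n → Vec (𝔽 p) n
a *ᵛ x = Vec.map (a *ᶠ_) x

_∙_ : .{{_ : NonZero p}} → Vec (𝔽 p) n → Vec (𝔽 p) n → 𝔽 p
u ∙ x = Vec.foldr′ _+ᶠ_ 0# (Vec.zipWith _*ᶠ_ u x)

basisVector : .{{_ : NonZero p}} → Fin n → Vec (𝔽 p) n
basisVector i = 0ᵛ [ i ]≔ 1#

infix 4 _≟ᵛ_
_≟ᵛ_ : (x y : Vec (𝔽 p) n) → Dec (x ≡ y)
_≟ᵛ_ = Vec.≡-dec Fin._≟_

wt : .{{_ : NonZero p}} → Vec (𝔽 p) n → ℕ
wt = Vec.count (λ a → ¬? (a Fin.≟ 0#))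

dist : Vec (𝔽 p) n → Vec (𝔽 p) n → ℕ
dist x y = Vec.count (λ (a , b) → ¬? (a Fin.≟ b)) (Vec.zip x y)

Code : ℕ → ℕ → Set₁
Code p N = Pred (Vec (𝔽 p) N) 0ℓ

record IsLinear .{{_ : NonZero p}} (C : Code p N) : Set where
  field
    0-mem    : C 0ᵛ
    +-closed : ∀ {x y} → C x → C y → C (x +ᵛ y)
    *-closed : ∀ a {x} → C x → C (a *ᵛ x)

combination : .{{_ : NonZero p}} {k : ℕ} → Vec (𝔽 p) k → Vec (Vec (𝔽 p) N) k → Vec (𝔽 p) N
combination a g = Vec.foldr′ _+ᵛ_ 0ᵛ (Vec.zipWith _*ᵛ_ a g)

record IsBasis .{{_ : NonZero p}} (C : Code p N) {k : ℕ} (g : Vec (Vec (𝔽 p) N) k) : Set where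
  field
    members     : All C g
    independent : ∀ a → combination a g ≡ 0ᵛ → a ≡ 0ᵛ
    spanning    : ∀ {x} → C x → ∃ λ a → x ≡ combination a g

record HasDimension .{{_ : NonZero p}} (C : Code p N) (k : ℕ) : Set where
  field
    linear  : IsLinear C
    basis   : Vec (Vec (𝔽 p) N) k
    isBasis : IsBasis C basis

record HasMinimumDistance (C : Code p N) (d : ℕ) : Set where
  field
    attained : ∃ λ x → ∃ λ y → C x × C y × x ≢ y × dist x y ≡ d
    minimal  : ∀ {x y} → C x → C y → x ≢ y → d ≤ dist x y

infix 4 _Is[_,_,_]
record _Is[_,_,_] .{{_ : NonZero p}} (C : Code p N) (N′ k d : ℕ) : Set where
  field
    hasLength          : N ≡ N′
    hasDimension       : HasDimension C k
    hasMinimumDistance : HasMinimumDistance C d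

IsNonzeroWeight : .{{_ : NonZero p}} → Code p N → ℕ → Set
IsNonzeroWeight C w = w ≢ 0 × ∃ λ c → C c × wt c ≡ w

record HasNonzeroWeights .{{_ : NonZero p}} (C : Code p N) (ws : List ℕ) : Set where
  field
    distinct : Unique ws
    exact    : ∀ w → w List.∈ ws ⇔ IsNonzeroWeight C w

Is_-Weight : ℕ → .{{_ : NonZero p}} → Code p N → Set
Is s -Weight C = ∃ λ ws → length ws ≡ s × HasNonzeroWeights C ws

allVecs : ∀ p n → List (Vec (𝔽 p) n)
allVecs p zero    = [] ∷ []
allVecs p (suc n) = cartesianProductWith _∷_ (List.allFin p) (allVecs p n)

∈-allVecs : (x : Vec (𝔽 p) n) → x List.∈ allVecs p n
∈-allVecs []      = here refl
∈-allVecs (a ∷ x) = List.∈-cartesianProductWith⁺ _∷_ (List.∈-allFin a) (∈-allVecs x)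

allVecs-unique : ∀ p n → Unique (allVecs p n)
allVecs-unique p zero    = [] ∷ []
allVecs-unique p (suc n) =
  Unique.cartesianProductWith⁺ _∷_ Vec.∷-injective (Unique.allFin⁺ p) (allVecs-unique p n)

elements : {D : Pred (Vec (𝔽 p) n) 0ℓ} → Decidable D → List (Vec (𝔽 p) n)
elements {p} {n} D? = filter D? (allVecs p n)

size : {D : Pred (Vec (𝔽 p) n) 0ℓ} → Decidable D → ℕ
size D? = length (elements D?)

-- The coordinates of c_D(u) are listed in the order of `elements D?`;
-- another order gives a code differing by a permutation of coordinates.
codeword : .{{_ : NonZero p}} {D : Pred (Vec (𝔽 p) n) 0ℓ} (D? : Decidable D) →
           Vec (𝔽 p) n → Vec (𝔽 p) (size D?)
codeword D? u = Vec.map (u ∙_) (Vec.fromList (elements D?))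

code : .{{_ : NonZero p}} {D : Pred (Vec (𝔽 p) n) 0ℓ} (D? : Decidable D) → Code p (size D?)
code D? c = ∃ λ u → c ≡ codeword D? u

-- The subset [m] of [n]; `Fin n` counts from 0.
initial : ∀ m {n} → Subset n
initial m = Vec.tabulate (λ i → does (toℕ i ℕ.<? m))

Precedes : ∀ m {n} → Rel (Fin n) 0ℓ
Precedes m i j = i ∈ initial m × j ∉ initial m

IsOrderIdeal : ∀ m {n} → Subset n → Set
IsOrderIdeal m S = ∀ i j → Precedes m i j → j ∈ S → i ∈ S

-- A sub-multiset of [n]_{p-1} is its multiplicity vector in 𝔽ₚⁿ.
support : .{{_ : NonZero p}} → Vec (𝔽 p) n → Subset n
support = Vec.map (λ a → not (does (a Fin.≟ 0#)))

infix 4 _⊑_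
_⊑_ : Vec (𝔽 p) n → Vec (𝔽 p) n → Set
_⊑_ = Pointwise Fin._≤_

IsUnsaturatedIdeal : .{{_ : NonZero p}} → ∀ m → Vec (𝔽 p) n → Set
IsUnsaturatedIdeal m J = IsOrderIdeal m (support J)

-- The set I(𝔾ℙ) for I an unsaturated generalized order ideal.
IdealsWithin : .{{_ : NonZero p}} → ∀ m → Vec (𝔽 p) n → Pred (Vec (𝔽 p) n) 0ℓ
IdealsWithin m I J = IsUnsaturatedIdeal m J × J ⊑ I

idealsWithin? : .{{_ : NonZero p}} → ∀ m (I : Vec (𝔽 p) n) → Decidable (IdealsWithin m I)
idealsWithin? m I J =
  Fin.all? (λ i → Fin.all? λ j →
    ((i ∈? initial m) ×-dec ¬? (j ∈? initial m)) →-dec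
    ((j ∈? support J) →-dec (i ∈? support J)))
  ×-dec Pointwise.decidable Fin._≤?_ J I

fullIdeal : .{{_ : NonZero p}} → ∀ m → Subset n → Vec (𝔽 p) n
fullIdeal {p} m B = Vec.map (λ s → if s then (p ∸ 1) mod p else 0#) (initial m ∪ B)

support-full : .{{_ : NonZero p}} → 1 < p → (S : Subset n) →
               support (Vec.map (λ s → if s then (p ∸ 1) mod p else 0#) S) ≡ S
support-full 1<p []            = refl
support-full {p} 1<p (true ∷ S) with (p ∸ 1) mod p Fin.≟ 0#
... | no  _  = cong (true ∷_) (support-full 1<p S)
support-full {suc (suc p)} (s≤s _) (true ∷ S) | yes eq = contradiction
  (trans (sym (m<n⇒m%n≡m (ℕ.n<1+n (suc p))))
    (trans (sym (Fin.toℕ-fromℕ< _)) (cong toℕ eq)))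
  λ ()
support-full {p} 1<p (false ∷ S) with 0# {p} Fin.≟ 0#
... | yes _  = cong (false ∷_) (support-full 1<p S)
... | no  ¬e = contradiction refl ¬e

fullIdeal-isUnsaturatedIdeal : .{{_ : NonZero p}} → 1 < p → ∀ m (B : Subset n) →
                               IsUnsaturatedIdeal {p} m (fullIdeal m B)
fullIdeal-isUnsaturatedIdeal 1<p m B i j (i∈ , _) _ =
  subst (i ∈_) (sym (support-full 1<p (initial m ∪ B))) (x∈p∪q⁺ (inj₁ i∈))

DefiningSet : ∀ p .{{_ : NonZero p}} m → Subset n → Pred (Vec (𝔽 p) n) 0ℓ
DefiningSet p m B = ∁ (IdealsWithin m (fullIdeal m B))

definingSet? : ∀ p .{{_ : NonZero p}} m (B : Subset n) → Decidable (DefiningSet p m B)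
definingSet? p m B = ∁? (idealsWithin? m (fullIdeal m B))

module _ {m n : ℕ} (m≤n : m ≤ n) where

  split : {A : Set} → Vec A n → Vec A (m ℕ.+ (n ∸ m))
  split = Vec.cast (sym (ℕ.m+[n∸m]≡n m≤n))

  vPart : {A : Set} → Vec A n → Vec A m
  vPart = Vec.take m ∘ split

  wPart : {A : Set} → Vec A n → Vec A (n ∸ m)
  wPart = Vec.drop m ∘ split

iverson : {A : Set} → Dec A → ℕ
iverson a? = if does a? then 1 else 0

VanishesOn : .{{_ : NonZero p}} → Subset n → Vec (𝔽 p) n → Set
VanishesOn B u = ∀ i → i ∈ B → lookup u i ≡ 0#

vanishesOn? : .{{_ : NonZero p}} → (B : Subset n) → Decidable (VanishesOn {p} B)
vanishesOn? B u = Fin.all? (λ i → (i ∈? B) →-dec (lookup u i Fin.≟ 0#))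

-- For B ⊆ [n]∖[m] every coordinate of u = (v , w) read here belongs to w.
δ : .{{_ : NonZero p}} → Subset n → Vec (𝔽 p) n → ℕ
δ B u = iverson (vanishesOn? B u)

{-# OPTIONS --safe #-}
module Submission where

-- Everything follows from the character sum of D at a vector u, namely the
-- sum over x in D of chi(u . x) for a nontrivial character chi of the prime
-- field. If S is a set of vectors closed under multiplication by units, its
-- character sum t at u is an integer, and the number N(c) of x in S with
-- u . x = c satisfies
--
--     p N(c) = |S| - t + p t [c = 0]   for every c.
--
-- Only this relation is used, so t may be given by an integer formula and no
-- complex numbers are needed. For the three coordinate sets "everything",
-- "units" and "zero" the relation holds with t = p [u = 0], p [u = 0] - 1 and
-- 1 (`spectrum`); this is where p being prime enters. It passes to Cartesian
-- products, called boxes below, with both |S| and t multiplicative, by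
-- induction on the number of coordinates (`boxSpectrum`).
--
-- Write a vector as (x , y) with x the m lower and y the n - m upper
-- coordinates. If y has a nonzero entry, then the support is an order ideal
-- exactly if x has no zero entry. Hence I(GP) is the union of the box
-- "y = 0" and the box "x without zeros, y supported on B", which meet in the
-- box "x without zeros, y = 0" (`ideal⇒box`, `box⇒ideal`). So the indicator
-- function of D is a combination of four box indicators, with
-- signs +, -, -, + (`⟦D⟧`), and |D| and the character sum of D are the same
-- combinations of the values of the boxes (`size-D`, `transform-D`). As the
-- weight is |D| - N(0), this gives p wt = (p - 1) (|D| - t), the weight
-- formula (`weight-formula`).
--
-- For the dimension, D contains a unit vector at an upper coordinate and its
-- sums with all the other unit vectors, unless m = 1 and B is the whole upper
-- level (`codeword-injective`). The frequencies are products of independent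
-- counts for x and y (`count-by`). The weight depends only on (k , δ), which
-- takes at most 2 (m + 1) values (`fewWeights-D`). For m = 1 the four values
-- of (k , δ) give three weights, as the two with δ = 0 agree (`weight-0`). In
-- the degenerate case D consists of the (0 , y) with y nonzero, and the same
-- formula gives a single nonzero weight (`weight-degenerate`).

open import Defs
open import Data.Nat using (ℕ; NonZero; _∸_; _≤_; _<_; z≤n)
import Data.Nat as ℕ
open import Data.Nat.Combinatorics using (_C_)
open import Data.Nat.Divisibility using (_∣_)
open import Data.Nat.Primality using (Prime)
open import Data.Nat.Properties using (<⇒≤; ≤-<-trans)
open import Data.Integer using (ℤ; +_; _+_; _-_; _*_; _^_; 1ℤ; -1ℤ)
import Data.Rational as ℚ
open import Data.Fin using (fromℕ<)
open import Data.Fin.Subset using (Subset; ∣_∣; ∁; _⊆_)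
open import Data.List using ([]; _∷_)
open import Data.Product using (∃; _×_)
open import Data.Vec using (Vec)
open import Function using (_⇔_)
open import Relation.Binary.PropositionalEquality using (_≡_; _≢_)
open import Relation.Nullary using (¬_; ¬?; _×-dec_)
open import Algebra.Bundles using (CommutativeRing)
open import Data.Bool using (Bool; true; false; if_then_else_; _∨_; not)
open import Data.Fin using (Fin; toℕ; _↑ˡ_; _↑ʳ_)
import Data.Fin as Fin
import Data.Fin.Properties as Fin
open import Data.Fin.Subset using (inside; outside; _∈_; _∉_; _∪_)
open import Data.Fin.Subset.Properties using (∣∁p∣≡n∸∣p∣; ∣p∣≡n⇒p≡⊤; ∣p∣≤n; drop-there)
open import Data.Integer using (0ℤ)
import Data.Integer as ℤ
import Data.Integer.Properties as ℤ
open import Data.Integer.Tactic.RingSolver using (solve-∀)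
open import Data.List as List using (List; length; upTo; filter; deduplicate; allFin; cartesianProductWith)
open import Data.List.Membership.Propositional using (find; lose) renaming (_∈_ to _∈ˡ_)
open import Data.List.Membership.Propositional.Properties using (∈-allFin; ∈-filter⁺; ∈-filter⁻; ∈-deduplicate⁺; ∈-upTo⁺; ∈-map⁺; ∈-++⁺ˡ; ∈-++⁺ʳ)
import Data.List.Properties as List
open import Data.List.Relation.Unary.All as All using (All; []; _∷_)
open import Data.List.Relation.Unary.AllPairs using ([]; _∷_)
open import Data.List.Relation.Unary.Any as Any using (here; there)
open import Data.List.Relation.Unary.Unique.DecPropositional.Properties ℕ._≟_ using (deduplicate-!)
open import Data.List.Relation.Unary.Unique.Propositional using (Unique)
import Data.List.Relation.Unary.Unique.Propositional.Properties as Unique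
open import Data.Nat using (s≤s)
open import Data.Nat.Combinatorics using (nCk+nC[k+1]≡[n+1]C[k+1])
import Data.Nat.Coprimality as Coprimality
open import Data.Nat.DivMod using (_%_; _mod_; m<n⇒m%n≡m; %-distribˡ-+; %-distribˡ-*; m*n%n≡0; n%n≡0; m*n/n≡m)
open import Data.Nat.GCD using (module Bézout)
open import Data.Nat.Primality using (prime⇒nonTrivial)
import Data.Nat.Properties as ℕ
open import Data.Product using (_,_; proj₁; proj₂)
import Data.Rational.Properties as ℚ
import Data.Rational.Unnormalised as ℚᵘ
import Data.Rational.Unnormalised.Properties as ℚᵘ
open import Data.Sum using (_⊎_; inj₁; inj₂; [_,_]′)
open import Data.Unit using (⊤; tt)
open import Data.Vec as Vec using ([]; _∷_; lookup; replicate; _++_)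
import Data.Vec.Properties as Vec
import Data.Vec.Relation.Binary.Pointwise.Inductive as Pointwise
open import Data.Vec.Relation.Binary.Pointwise.Extensional using (ext; extensional⇒inductive)
open import Data.Vec.Relation.Unary.All using ([]; _∷_) renaming (All to Allᵛ)
open import Function using (_∘_; mk⇔)
open import Level using (0ℓ)
open import Relation.Binary.Definitions using (DecidableEquality)
open import Relation.Binary.PropositionalEquality using (refl; sym; trans; cong; cong₂; subst; isEquivalence; module ≡-Reasoning)
open import Relation.Nullary using (Dec; yes; no; does; contradiction; _⊎-dec_)
open import Relation.Nullary.Decidable using (dec-true; dec-false; map′)
open import Relation.Unary using (Pred; Decidable)

-- Arithmetic of the prime field

module Field (p : ℕ) .{{_ : NonZero p}} where

  -- The residue class of a natural number.
  [_] : ℕ → 𝔽 p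
  [ k ] = k mod p

  toℕ-[_] : ∀ k → toℕ [ k ] ≡ k % p
  toℕ-[ k ] = Fin.toℕ-fromℕ< _

  []-cong : ∀ {k l} → k % p ≡ l % p → [ k ] ≡ [ l ]
  []-cong {k} {l} eq = Fin.toℕ-injective (trans toℕ-[ k ] (trans eq (sym toℕ-[ l ])))

  [toℕ] : ∀ a → [ toℕ a ] ≡ a
  [toℕ] a = Fin.toℕ-injective (trans toℕ-[ toℕ a ] (m<n⇒m%n≡m (Fin.toℕ<n a)))

  []-+ : ∀ k l → [ k ] +ᶠ [ l ] ≡ [ k ℕ.+ l ]
  []-+ k l = []-cong (trans (cong₂ (λ x y → (x ℕ.+ y) % p) toℕ-[ k ] toℕ-[ l ])
                            (sym (%-distribˡ-+ k l p)))

  []-* : ∀ k l → [ k ] *ᶠ [ l ] ≡ [ k ℕ.* l ]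
  []-* k l = []-cong (trans (cong₂ (λ x y → (x ℕ.* y) % p) toℕ-[ k ] toℕ-[ l ])
                            (sym (%-distribˡ-* k l p)))

  +-[]ˡ : ∀ k a → [ k ] +ᶠ a ≡ [ k ℕ.+ toℕ a ]
  +-[]ˡ k a = trans (cong ([ k ] +ᶠ_) (sym ([toℕ] a))) ([]-+ k (toℕ a))

  *-[]ˡ : ∀ k a → [ k ] *ᶠ a ≡ [ k ℕ.* toℕ a ]
  *-[]ˡ k a = trans (cong ([ k ] *ᶠ_) (sym ([toℕ] a))) ([]-* k (toℕ a))

  +ᶠ-comm : ∀ a b → a +ᶠ b ≡ b +ᶠ a
  +ᶠ-comm a b = cong [_] (ℕ.+-comm (toℕ a) (toℕ b))

  *ᶠ-comm : ∀ a b → a *ᶠ b ≡ b *ᶠ a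
  *ᶠ-comm a b = cong [_] (ℕ.*-comm (toℕ a) (toℕ b))

  +ᶠ-assoc : ∀ a b c → (a +ᶠ b) +ᶠ c ≡ a +ᶠ (b +ᶠ c)
  +ᶠ-assoc a b c = begin
    (a +ᶠ b) +ᶠ c                         ≡⟨ +-[]ˡ _ c ⟩
    [ toℕ a ℕ.+ toℕ b ℕ.+ toℕ c ]         ≡⟨ cong [_] (ℕ.+-assoc (toℕ a) (toℕ b) (toℕ c)) ⟩
    [ toℕ a ℕ.+ (toℕ b ℕ.+ toℕ c) ]       ≡⟨ []-+ (toℕ a) _ ⟨
    [ toℕ a ] +ᶠ (b +ᶠ c)                 ≡⟨ cong (_+ᶠ (b +ᶠ c)) ([toℕ] a) ⟩
    a +ᶠ (b +ᶠ c)                         ∎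
    where open ≡-Reasoning

  *ᶠ-assoc : ∀ a b c → (a *ᶠ b) *ᶠ c ≡ a *ᶠ (b *ᶠ c)
  *ᶠ-assoc a b c = begin
    (a *ᶠ b) *ᶠ c                         ≡⟨ *-[]ˡ _ c ⟩
    [ toℕ a ℕ.* toℕ b ℕ.* toℕ c ]         ≡⟨ cong [_] (ℕ.*-assoc (toℕ a) (toℕ b) (toℕ c)) ⟩
    [ toℕ a ℕ.* (toℕ b ℕ.* toℕ c) ]       ≡⟨ []-* (toℕ a) _ ⟨
    [ toℕ a ] *ᶠ (b *ᶠ c)                 ≡⟨ cong (_*ᶠ (b *ᶠ c)) ([toℕ] a) ⟩
    a *ᶠ (b *ᶠ c)                         ∎
    where open ≡-Reasoning

  *ᶠ-distribˡ-+ᶠ : ∀ a b c → a *ᶠ (b +ᶠ c) ≡ a *ᶠ b +ᶠ a *ᶠ c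
  *ᶠ-distribˡ-+ᶠ a b c = begin
    a *ᶠ (b +ᶠ c)                                      ≡⟨ cong (_*ᶠ (b +ᶠ c)) ([toℕ] a) ⟨
    [ toℕ a ] *ᶠ [ toℕ b ℕ.+ toℕ c ]                   ≡⟨ []-* (toℕ a) _ ⟩
    [ toℕ a ℕ.* (toℕ b ℕ.+ toℕ c) ]                    ≡⟨ cong [_] (ℕ.*-distribˡ-+ (toℕ a) (toℕ b) (toℕ c)) ⟩
    [ toℕ a ℕ.* toℕ b ℕ.+ toℕ a ℕ.* toℕ c ]            ≡⟨ []-+ _ _ ⟨
    a *ᶠ b +ᶠ a *ᶠ c                                   ∎
    where open ≡-Reasoning

  +ᶠ-identityˡ : ∀ a → 0# +ᶠ a ≡ a
  +ᶠ-identityˡ a = trans (+-[]ˡ 0 a) ([toℕ] a)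

  *ᶠ-identityˡ : ∀ a → 1# *ᶠ a ≡ a
  *ᶠ-identityˡ a = trans (*-[]ˡ 1 a) (trans (cong [_] (ℕ.*-identityˡ (toℕ a))) ([toℕ] a))

  -ᶠ_ : 𝔽 p → 𝔽 p
  -ᶠ a = [ p ∸ toℕ a ]

  -ᶠ-inverseˡ : ∀ a → (-ᶠ a) +ᶠ a ≡ 0#
  -ᶠ-inverseˡ a = trans (+-[]ˡ (p ∸ toℕ a) a) (trans
    (cong [_] (ℕ.m∸n+n≡m (ℕ.<⇒≤ (Fin.toℕ<n a))))
    ([]-cong {p} {0} (trans (n%n≡0 p) (sym (m<n⇒m%n≡m (ℕ.>-nonZero⁻¹ p))))))

  𝔽-commutativeRing : CommutativeRing 0ℓ 0ℓ
  𝔽-commutativeRing = record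
    { Carrier = 𝔽 p ; _≈_ = _≡_ ; _+_ = _+ᶠ_ ; _*_ = _*ᶠ_ ; -_ = -ᶠ_ ; 0# = 0# ; 1# = 1#
    ; isCommutativeRing = record
      { isRing = record
        { +-isAbelianGroup = record
          { isGroup = record
            { isMonoid = record
              { isSemigroup = record
                { isMagma = record { isEquivalence = isEquivalence ; ∙-cong = cong₂ _+ᶠ_ }
                ; assoc = +ᶠ-assoc }
              ; identity = +ᶠ-identityˡ , λ a → trans (+ᶠ-comm a 0#) (+ᶠ-identityˡ a) }
            ; inverse = -ᶠ-inverseˡ , λ a → trans (+ᶠ-comm a (-ᶠ a)) (-ᶠ-inverseˡ a)
            ; ⁻¹-cong = cong -ᶠ_ }
          ; comm = +ᶠ-comm }
        ; *-cong = cong₂ _*ᶠ_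
        ; *-assoc = *ᶠ-assoc
        ; *-identity = *ᶠ-identityˡ , λ a → trans (*ᶠ-comm a 1#) (*ᶠ-identityˡ a)
        ; distrib = *ᶠ-distribˡ-+ᶠ , λ a b c →
            trans (*ᶠ-comm (b +ᶠ c) a)
              (trans (*ᶠ-distribˡ-+ᶠ a b c) (cong₂ _+ᶠ_ (*ᶠ-comm a b) (*ᶠ-comm a c))) }
      ; *-comm = *ᶠ-comm } }

  open CommutativeRing 𝔽-commutativeRing public
    using (+-identityʳ; *-identityʳ; zeroˡ; zeroʳ; distribʳ; -‿inverseʳ; +-abelianGroup; ring;
           +-commutativeSemigroup; *-commutativeSemigroup)
  open import Algebra.Properties.AbelianGroup +-abelianGroup public using (xyx⁻¹≈y)
  open import Algebra.Properties.Ring ring public using (-‿distribˡ-*)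
  open import Algebra.Properties.CommutativeSemigroup +-commutativeSemigroup public
    using () renaming (interchange to +ᶠ-interchange)
  open import Algebra.Properties.CommutativeSemigroup *-commutativeSemigroup public
    using () renaming (x∙yz≈y∙xz to *ᶠ-leftSwap)

  toℕ-0# : toℕ (0# {p}) ≡ 0
  toℕ-0# = trans toℕ-[ 0 ] (m<n⇒m%n≡m (ℕ.>-nonZero⁻¹ p))

  module _ (prime : Prime p) where

    1<p : 1 < p
    1<p = ℕ.nonTrivial⇒n>1 p {{prime⇒nonTrivial prime}}

    1#≢0# : 1# {p} ≢ 0#
    1#≢0# eq = contradiction (trans (sym toℕ-0#) (trans (cong toℕ (sym eq)) (trans toℕ-[ 1 ] (m<n⇒m%n≡m 1<p)))) λ ()

    -- Nonzero residues are invertible, by Bézout's identity.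
    inverse : ∀ {a} → a ≢ 0# → ∃ λ b → b *ᶠ a ≡ 1#
    inverse {a} a≢0 = go (Coprimality.coprime-Bézout (Coprimality.prime⇒coprime prime {{ℕ.≢-nonZero toℕa≢0}} (Fin.toℕ<n a)))
      where
      open ≡-Reasoning
      toℕa≢0 : toℕ a ≢ 0
      toℕa≢0 eq = a≢0 (Fin.toℕ-injective (trans eq (sym toℕ-0#)))

      multiple : ∀ x → [ x ℕ.* p ] ≡ 0#
      multiple x = []-cong (trans (m*n%n≡0 x p) (sym (m<n⇒m%n≡m (ℕ.>-nonZero⁻¹ p))))

      go : Bézout.Identity 1 p (toℕ a) → ∃ λ b → b *ᶠ a ≡ 1#
      go (Bézout.-+ x y eq) = [ y ] , (begin
        [ y ] *ᶠ a               ≡⟨ *-[]ˡ y a ⟩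
        [ y ℕ.* toℕ a ]          ≡⟨ cong [_] eq ⟨
        [ 1 ℕ.+ x ℕ.* p ]        ≡⟨ []-+ 1 _ ⟨
        1# +ᶠ [ x ℕ.* p ]        ≡⟨ cong (1# +ᶠ_) (multiple x) ⟩
        1# +ᶠ 0#                 ≡⟨ +-identityʳ 1# ⟩
        1#                       ∎)
      go (Bézout.+- x y eq) = -ᶠ [ y ] , (begin
        (-ᶠ [ y ]) *ᶠ a                      ≡⟨ -‿distribˡ-* [ y ] a ⟨
        -ᶠ ([ y ] *ᶠ a)                      ≡⟨ +-identityʳ _ ⟨
        -ᶠ ([ y ] *ᶠ a) +ᶠ 0#                ≡⟨ cong (-ᶠ ([ y ] *ᶠ a) +ᶠ_) 1+ya≡0 ⟨
        -ᶠ ([ y ] *ᶠ a) +ᶠ (1# +ᶠ [ y ] *ᶠ a) ≡⟨ cong (-ᶠ ([ y ] *ᶠ a) +ᶠ_) (+ᶠ-comm 1# _) ⟩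
        -ᶠ ([ y ] *ᶠ a) +ᶠ ([ y ] *ᶠ a +ᶠ 1#) ≡⟨ +ᶠ-assoc _ _ 1# ⟨
        -ᶠ ([ y ] *ᶠ a) +ᶠ [ y ] *ᶠ a +ᶠ 1#  ≡⟨ cong (_+ᶠ 1#) (-ᶠ-inverseˡ ([ y ] *ᶠ a)) ⟩
        0# +ᶠ 1#                             ≡⟨ +ᶠ-identityˡ 1# ⟩
        1#                                   ∎)
        where
        1+ya≡0 : 1# +ᶠ [ y ] *ᶠ a ≡ 0#
        1+ya≡0 = begin
          1# +ᶠ [ y ] *ᶠ a               ≡⟨ cong (1# +ᶠ_) (*-[]ˡ y a) ⟩
          1# +ᶠ [ y ℕ.* toℕ a ]          ≡⟨ []-+ 1 _ ⟩
          [ 1 ℕ.+ y ℕ.* toℕ a ]          ≡⟨ cong [_] eq ⟩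
          [ x ℕ.* p ]                    ≡⟨ multiple x ⟩
          0#                             ∎

-- Iverson brackets

-- The Iverson bracket of a decided proposition, as an integer.
⟦_⟧ : {A : Set} → Dec A → ℤ
⟦ a? ⟧ = + iverson a?

⟦⟧-yes : {A : Set} (a? : Dec A) → A → ⟦ a? ⟧ ≡ 1ℤ
⟦⟧-yes (yes _) a = refl
⟦⟧-yes (no ¬a) a = contradiction a ¬a

⟦⟧-no : {A : Set} (a? : Dec A) → ¬ A → ⟦ a? ⟧ ≡ 0ℤ
⟦⟧-no (yes a) ¬a = contradiction a ¬a
⟦⟧-no (no _)  ¬a = refl

⟦⟧-cong : {A B : Set} (a? : Dec A) (b? : Dec B) → (A → B) → (B → A) → ⟦ a? ⟧ ≡ ⟦ b? ⟧
⟦⟧-cong (yes a) b? f g = sym (⟦⟧-yes b? (f a))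
⟦⟧-cong (no ¬a) b? f g = sym (⟦⟧-no b? (¬a ∘ g))

⟦⟧-× : {A B : Set} (a? : Dec A) (b? : Dec B) → ⟦ a? ×-dec b? ⟧ ≡ ⟦ a? ⟧ * ⟦ b? ⟧
⟦⟧-× (yes _) b? = sym (ℤ.*-identityˡ ⟦ b? ⟧)
⟦⟧-× (no _)  b? = refl

⟦⟧-¬ : {A : Set} (a? : Dec A) → ⟦ ¬? a? ⟧ ≡ 1ℤ - ⟦ a? ⟧
⟦⟧-¬ (yes _) = refl
⟦⟧-¬ (no _)  = refl

-- Finite sums

private variable
  A B E : Set

-- The sum of f over the entries of a list, counted with repetition.
∑ : List A → (A → ℤ) → ℤ
∑ []       f = 0ℤ
∑ (x ∷ xs) f = f x + ∑ xs f

∑-cong : ∀ (xs : List A) {f g : A → ℤ} → (∀ x → f x ≡ g x) → ∑ xs f ≡ ∑ xs g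
∑-cong []       eq = refl
∑-cong (x ∷ xs) eq = cong₂ _+_ (eq x) (∑-cong xs eq)

∑-+ : ∀ (xs : List A) {f g : A → ℤ} → ∑ xs (λ x → f x + g x) ≡ ∑ xs f + ∑ xs g
∑-+ []       = refl
∑-+ (x ∷ xs) {f} {g} = trans (cong (_+_ (f x + g x)) (∑-+ xs)) (lemma (f x) (g x) (∑ xs f) (∑ xs g))
  where
  lemma : ∀ a b c d → a + b + (c + d) ≡ (a + c) + (b + d)
  lemma = solve-∀

∑-*ˡ : ∀ c (xs : List A) {f : A → ℤ} → ∑ xs (λ x → c * f x) ≡ c * ∑ xs f
∑-*ˡ c []       = sym (ℤ.*-zeroʳ c)
∑-*ˡ c (x ∷ xs) {f} = trans (cong (_+_ (c * f x)) (∑-*ˡ c xs)) (sym (ℤ.*-distribˡ-+ c (f x) _))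

∑-*ʳ : ∀ c (xs : List A) {f : A → ℤ} → ∑ xs (λ x → f x * c) ≡ ∑ xs f * c
∑-*ʳ c []       = sym (ℤ.*-zeroˡ c)
∑-*ʳ c (x ∷ xs) {f} = trans (cong (_+_ (f x * c)) (∑-*ʳ c xs)) (sym (ℤ.*-distribʳ-+ c (f x) _))

∑-- : ∀ (xs : List A) {f g : A → ℤ} → ∑ xs (λ x → f x - g x) ≡ ∑ xs f - ∑ xs g
∑-- []       = refl
∑-- (x ∷ xs) {f} {g} = trans (cong (_+_ (f x - g x)) (∑-- xs)) (lemma (f x) (g x) (∑ xs f) (∑ xs g))
  where
  lemma : ∀ a b c d → a - b + (c - d) ≡ (a + c) - (b + d)
  lemma = solve-∀

∑-const : ∀ (xs : List A) c → ∑ xs (λ _ → c) ≡ + length xs * c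
∑-const []       c = refl
∑-const (x ∷ xs) c = trans (cong (_+_ c) (∑-const xs c)) (sym (ℤ.suc-* (+ length xs) c))

∑-map : ∀ (h : A → B) xs {f : B → ℤ} → ∑ (List.map h xs) f ≡ ∑ xs (f ∘ h)
∑-map h []       = refl
∑-map h (x ∷ xs) {f} = cong (_+_ (f (h x))) (∑-map h xs)

∑-++ : ∀ (xs ys : List A) {f : A → ℤ} → ∑ (xs List.++ ys) f ≡ ∑ xs f + ∑ ys f
∑-++ []       ys = sym (ℤ.+-identityˡ _)
∑-++ (x ∷ xs) ys {f} = trans (cong (_+_ (f x)) (∑-++ xs ys)) (sym (ℤ.+-assoc (f x) _ _))

∑-cartesianProductWith : ∀ (h : A → B → E) xs ys {f : E → ℤ} →
  ∑ (cartesianProductWith h xs ys) f ≡ ∑ xs (λ x → ∑ ys (λ y → f (h x y)))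
∑-cartesianProductWith h []       ys = refl
∑-cartesianProductWith h (x ∷ xs) ys =
  trans (∑-++ (List.map (h x) ys) _) (cong₂ _+_ (∑-map (h x) ys) (∑-cartesianProductWith h xs ys))

∑-filter : ∀ {P : Pred A 0ℓ} (P? : Decidable P) xs {f : A → ℤ} →
           ∑ (filter P? xs) f ≡ ∑ xs (λ x → ⟦ P? x ⟧ * f x)
∑-filter P? []       = refl
∑-filter P? (x ∷ xs) {f} with does (P? x)
... | true  = cong₂ _+_ (sym (ℤ.*-identityˡ (f x))) (∑-filter P? xs)
... | false = trans (∑-filter P? xs) (sym (ℤ.+-identityˡ _))

length≡∑ : ∀ (xs : List A) → + length xs ≡ ∑ xs (λ _ → 1ℤ)
length≡∑ xs = sym (trans (∑-const xs 1ℤ) (ℤ.*-identityʳ _))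

-- Exactly one entry of a repetition-free list equals a given member.
∑-single : (_≟_ : DecidableEquality A) {xs : List A} → Unique xs → ∀ {a} → a ∈ˡ xs →
           ∑ xs (λ x → ⟦ x ≟ a ⟧) ≡ 1ℤ
∑-single _≟_ {x ∷ xs} (x∉ ∷ _) (here refl) = cong₂ _+_ (⟦⟧-yes (x ≟ x) refl) (none x∉)
  where
  none : ∀ {ys} → All (x ≢_) ys → ∑ ys (λ y → ⟦ y ≟ x ⟧) ≡ 0ℤ
  none []                = refl
  none (_∷_ {x = y} x≢y x∉) = cong₂ _+_ (⟦⟧-no (y ≟ x) (x≢y ∘ sym)) (none x∉)
∑-single _≟_ {x ∷ xs} (x∉ ∷ u) {a} (there a∈xs) =
  cong₂ _+_ (⟦⟧-no (x ≟ a) (All.lookup x∉ a∈xs)) (∑-single _≟_ u a∈xs)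

∑-allFin-single : ∀ {p} (a : Fin p) → ∑ (allFin p) (λ x → ⟦ x Fin.≟ a ⟧) ≡ 1ℤ
∑-allFin-single a = ∑-single Fin._≟_ (Unique.allFin⁺ _) (∈-allFin a)

∑-allVecs-suc : ∀ p n {f : Vec (𝔽 p) (ℕ.suc n) → ℤ} →
  ∑ (allVecs p (ℕ.suc n)) f ≡ ∑ (allFin p) (λ a → ∑ (allVecs p n) (λ x → f (a ∷ x)))
∑-allVecs-suc p n = ∑-cartesianProductWith _∷_ (allFin p) (allVecs p n)

∑-allVecs-++ : ∀ p m n {f : Vec (𝔽 p) (m ℕ.+ n) → ℤ} →
  ∑ (allVecs p (m ℕ.+ n)) f ≡ ∑ (allVecs p m) (λ x → ∑ (allVecs p n) (λ y → f (x ++ y)))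
∑-allVecs-++ p ℕ.zero    n = sym (ℤ.+-identityʳ _)
∑-allVecs-++ p (ℕ.suc m) n = trans (∑-allVecs-suc p (m ℕ.+ n))
  (trans (∑-cong (allFin p) (λ a → ∑-allVecs-++ p m n)) (sym (∑-allVecs-suc p m)))

size≡∑ : ∀ {p n} {D : Pred (Vec (𝔽 p) n) 0ℓ} (D? : Decidable D) → + size D? ≡ ∑ (allVecs p n) (λ x → ⟦ D? x ⟧)
size≡∑ {p} {n} D? = trans (length≡∑ (elements D?))
  (trans (∑-filter D? (allVecs p n)) (∑-cong (allVecs p n) λ x → ℤ.*-identityʳ _))

-- The weight of a codeword as a sum over all vectors, so that D enters only
-- through its indicator function.
wt-codeword≡∑ : ∀ {p n} .{{_ : NonZero p}} {D : Pred (Vec (𝔽 p) n) 0ℓ} (D? : Decidable D) u →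
  + wt (codeword D? u) ≡ ∑ (allVecs p n) (λ x → ⟦ D? x ⟧ * (1ℤ - ⟦ u ∙ x Fin.≟ 0# ⟧))
wt-codeword≡∑ {p} {n} D? u = trans (go (elements D?)) (∑-filter D? (allVecs p n))
  where
  go : ∀ xs → + wt (Vec.map (u ∙_) (Vec.fromList xs)) ≡ ∑ xs (λ x → 1ℤ - ⟦ u ∙ x Fin.≟ 0# ⟧)
  go []       = refl
  go (x ∷ xs) with does (u ∙ x Fin.≟ 0#)
  ... | true  = trans (go xs) (sym (ℤ.+-identityˡ _))
  ... | false = cong (_+_ 1ℤ) (go xs)

-- Character sums of boxes

-- The coordinate sets from which boxes are built: all of the field, its
-- units, and zero alone.
data Kind : Set where
  full unit null : Kind

module Spectrum (p : ℕ) .{{_ : NonZero p}} where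
  open Field p

  P : ℤ
  P = + p

  -- The indicator function of a coordinate set.
  indicator : Kind → 𝔽 p → ℤ
  indicator full a = 1ℤ
  indicator unit a = 1ℤ - ⟦ a Fin.≟ 0# ⟧
  indicator null a = ⟦ a Fin.≟ 0# ⟧

  cardinality : Kind → ℤ
  cardinality full = P
  cardinality unit = P - 1ℤ
  cardinality null = 1ℤ

  -- The character sum at u of a coordinate set, that is, the sum of chi(u a)
  -- over its elements a, for any nontrivial character chi of the field.
  transform : Kind → 𝔽 p → ℤ
  transform full u = P * ⟦ u Fin.≟ 0# ⟧
  transform unit u = P * ⟦ u Fin.≟ 0# ⟧ - 1ℤ
  transform null u = 1ℤ

  -- A vector of kinds describes the box that is the product of the coordinate
  -- sets. Its indicator function, size and character sum are products.
  boxIndicator : ∀ {n} → Vec Kind n → Vec (𝔽 p) n → ℤ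
  boxIndicator []       []      = 1ℤ
  boxIndicator (κ ∷ κs) (a ∷ x) = indicator κ a * boxIndicator κs x

  boxCardinality : ∀ {n} → Vec Kind n → ℤ
  boxCardinality []       = 1ℤ
  boxCardinality (κ ∷ κs) = cardinality κ * boxCardinality κs

  boxTransform : ∀ {n} → Vec Kind n → Vec (𝔽 p) n → ℤ
  boxTransform []       []      = 1ℤ
  boxTransform (κ ∷ κs) (a ∷ u) = transform κ a * boxTransform κs u

  ∑-const-𝔽 : ∀ c → ∑ (allFin p) (λ _ → c) ≡ P * c
  ∑-const-𝔽 c = trans (∑-const (allFin p) c) (cong (λ k → + k * c) (List.length-tabulate {n = p} (λ i → i)))

  ∑-indicator : ∀ κ → ∑ (allFin p) (indicator κ) ≡ cardinality κ
  ∑-indicator full = trans (∑-const-𝔽 1ℤ) (ℤ.*-identityʳ P)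
  ∑-indicator unit = trans (∑-- (allFin p)) (cong₂ _-_ (∑-indicator full) (∑-indicator null))
  ∑-indicator null = ∑-allFin-single 0#

  ∑-boxIndicator : ∀ {n} (κs : Vec Kind n) → ∑ (allVecs p n) (boxIndicator κs) ≡ boxCardinality κs
  ∑-boxIndicator []                 = refl
  ∑-boxIndicator {ℕ.suc n} (κ ∷ κs) = begin
    ∑ (allVecs p (ℕ.suc n)) (boxIndicator (κ ∷ κs))
      ≡⟨ ∑-allVecs-suc p n ⟩
    ∑ (allFin p) (λ a → ∑ (allVecs p n) (λ x → indicator κ a * boxIndicator κs x))
      ≡⟨ ∑-cong (allFin p) (λ a → ∑-*ˡ (indicator κ a) (allVecs p n)) ⟩
    ∑ (allFin p) (λ a → indicator κ a * ∑ (allVecs p n) (boxIndicator κs))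
      ≡⟨ ∑-*ʳ _ (allFin p) ⟩
    ∑ (allFin p) (indicator κ) * ∑ (allVecs p n) (boxIndicator κs)
      ≡⟨ cong₂ _*_ (∑-indicator κ) (∑-boxIndicator κs) ⟩
    cardinality κ * boxCardinality κs ∎
    where open ≡-Reasoning

  shift⇒ : ∀ a b c → a +ᶠ b ≡ c → b ≡ c +ᶠ -ᶠ a
  shift⇒ a b c refl = sym (xyx⁻¹≈y a b)

  shift⇐ : ∀ a b c → b ≡ c +ᶠ -ᶠ a → a +ᶠ b ≡ c
  shift⇐ a b c refl = trans (sym (+ᶠ-assoc a c (-ᶠ a))) (xyx⁻¹≈y a c)

  module _ (prime : Prime p) where

    ∑-solutions : ∀ {u} → u ≢ 0# → ∀ c → ∑ (allFin p) (λ a → ⟦ u *ᶠ a Fin.≟ c ⟧) ≡ 1ℤ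
    ∑-solutions {u} u≢0 c with inverse prime u≢0
    ... | v , vu≡1 = trans (∑-cong (allFin p) λ a → ⟦⟧-cong (u *ᶠ a Fin.≟ c) (a Fin.≟ v *ᶠ c) (to a) (from a))
                           (∑-allFin-single (v *ᶠ c))
      where
      open ≡-Reasoning
      to : ∀ a → u *ᶠ a ≡ c → a ≡ v *ᶠ c
      to a refl = begin
        a               ≡⟨ *ᶠ-identityˡ a ⟨
        1# *ᶠ a         ≡⟨ cong (_*ᶠ a) vu≡1 ⟨
        v *ᶠ u *ᶠ a     ≡⟨ *ᶠ-assoc v u a ⟩
        v *ᶠ (u *ᶠ a)   ∎
      from : ∀ a → a ≡ v *ᶠ c → u *ᶠ a ≡ c
      from a refl = begin
        u *ᶠ (v *ᶠ c)   ≡⟨ *ᶠ-leftSwap u v c ⟩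
        v *ᶠ (u *ᶠ c)   ≡⟨ *ᶠ-assoc v u c ⟨
        v *ᶠ u *ᶠ c     ≡⟨ cong (_*ᶠ c) vu≡1 ⟩
        1# *ᶠ c         ≡⟨ *ᶠ-identityˡ c ⟩
        c               ∎

    -- Every coordinate set S is closed under multiplication by units, so the
    -- number of a in S with u a = c is the same for all nonzero c. It is
    -- (s - t) / p, plus t if c = 0, where s is the size of S and t its
    -- character sum at u.
    spectrum : ∀ κ u c → P * ∑ (allFin p) (λ a → indicator κ a * ⟦ u *ᶠ a Fin.≟ c ⟧)
                         ≡ cardinality κ - transform κ u + P * transform κ u * ⟦ 0# Fin.≟ c ⟧
    spectrum full u c = trans (cong (P *_) (∑-cong (allFin p) λ a → ℤ.*-identityˡ _)) (go (u Fin.≟ 0#))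
      where
      open ≡-Reasoning
      go : (d : Dec (u ≡ 0#)) → P * ∑ (allFin p) (λ a → ⟦ u *ᶠ a Fin.≟ c ⟧)
                      ≡ P - P * ⟦ d ⟧ + P * (P * ⟦ d ⟧) * ⟦ 0# Fin.≟ c ⟧
      go (yes refl) = begin
        P * ∑ (allFin p) (λ a → ⟦ 0# *ᶠ a Fin.≟ c ⟧)  ≡⟨ cong (P *_) (∑-cong (allFin p) λ a → cong (λ z → ⟦ z Fin.≟ c ⟧) (zeroˡ a)) ⟩
        P * ∑ (allFin p) (λ a → ⟦ 0# Fin.≟ c ⟧)       ≡⟨ cong (P *_) (∑-const-𝔽 _) ⟩
        P * (P * ⟦ 0# Fin.≟ c ⟧)                      ≡⟨ lemma P ⟦ 0# Fin.≟ c ⟧ ⟩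
        P - P * 1ℤ + P * (P * 1ℤ) * ⟦ 0# Fin.≟ c ⟧   ∎
        where
        lemma : ∀ P d → P * (P * d) ≡ P - P * 1ℤ + P * (P * 1ℤ) * d
        lemma = solve-∀
      go (no u≢0) = trans (cong (P *_) (∑-solutions u≢0 c)) (lemma P ⟦ 0# Fin.≟ c ⟧)
        where
        lemma : ∀ P d → P * 1ℤ ≡ P - P * 0ℤ + P * (P * 0ℤ) * d
        lemma = solve-∀
    spectrum unit u c = begin
      P * ∑ (allFin p) (λ a → (1ℤ - ⟦ a Fin.≟ 0# ⟧) * ⟦ u *ᶠ a Fin.≟ c ⟧)
        ≡⟨ cong (P *_) (∑-cong (allFin p) λ a → distrib ⟦ a Fin.≟ 0# ⟧ ⟦ u *ᶠ a Fin.≟ c ⟧) ⟩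
      P * ∑ (allFin p) (λ a → 1ℤ * ⟦ u *ᶠ a Fin.≟ c ⟧ - ⟦ a Fin.≟ 0# ⟧ * ⟦ u *ᶠ a Fin.≟ c ⟧)
        ≡⟨ cong (P *_) (∑-- (allFin p)) ⟩
      P * (all - zeros)
        ≡⟨ minus P all zeros ⟩
      P * all - P * zeros
        ≡⟨ cong₂ _-_ (spectrum full u c) (spectrum null u c) ⟩
      (P - t + P * t * d) - (1ℤ - 1ℤ + P * 1ℤ * d)
        ≡⟨ lemma P t d ⟩
      P - 1ℤ - (t - 1ℤ) + P * (t - 1ℤ) * d ∎
      where
      open ≡-Reasoning
      all zeros d t : ℤ
      all   = ∑ (allFin p) (λ a → 1ℤ * ⟦ u *ᶠ a Fin.≟ c ⟧)
      zeros = ∑ (allFin p) (λ a → ⟦ a Fin.≟ 0# ⟧ * ⟦ u *ᶠ a Fin.≟ c ⟧)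
      d = ⟦ 0# Fin.≟ c ⟧
      t = transform full u
      distrib : ∀ z e → (1ℤ - z) * e ≡ 1ℤ * e - z * e
      distrib = solve-∀
      minus : ∀ P x y → P * (x - y) ≡ P * x - P * y
      minus = solve-∀
      lemma : ∀ P t d → (P - t + P * t * d) - (1ℤ - 1ℤ + P * 1ℤ * d) ≡ P - 1ℤ - (t - 1ℤ) + P * (t - 1ℤ) * d
      lemma = solve-∀
    spectrum null u c = begin
      P * ∑ (allFin p) (λ a → ⟦ a Fin.≟ 0# ⟧ * ⟦ u *ᶠ a Fin.≟ c ⟧)
        ≡⟨ cong (P *_) (∑-cong (allFin p) λ a → only-zero a (a Fin.≟ 0#)) ⟩
      P * ∑ (allFin p) (λ a → ⟦ a Fin.≟ 0# ⟧ * ⟦ 0# Fin.≟ c ⟧)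
        ≡⟨ cong (P *_) (∑-*ʳ ⟦ 0# Fin.≟ c ⟧ (allFin p)) ⟩
      P * (∑ (allFin p) (λ a → ⟦ a Fin.≟ 0# ⟧) * ⟦ 0# Fin.≟ c ⟧)
        ≡⟨ cong (λ s → P * (s * ⟦ 0# Fin.≟ c ⟧)) (∑-indicator null) ⟩
      P * (1ℤ * ⟦ 0# Fin.≟ c ⟧)
        ≡⟨ lemma P ⟦ 0# Fin.≟ c ⟧ ⟩
      1ℤ - 1ℤ + P * 1ℤ * ⟦ 0# Fin.≟ c ⟧ ∎
      where
      open ≡-Reasoning
      only-zero : ∀ a (d : Dec (a ≡ 0#)) → ⟦ d ⟧ * ⟦ u *ᶠ a Fin.≟ c ⟧ ≡ ⟦ d ⟧ * ⟦ 0# Fin.≟ c ⟧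
      only-zero a (yes refl) = cong (λ z → 1ℤ * ⟦ z Fin.≟ c ⟧) (zeroʳ u)
      only-zero a (no _)     = refl
      lemma : ∀ P d → P * (1ℤ * d) ≡ 1ℤ - 1ℤ + P * 1ℤ * d
      lemma = solve-∀

    -- The same law for a box. The induction step fixes the first coordinate b
    -- and applies the law for the remaining ones to the value c - a b.
    boxSpectrum : ∀ {n} (κs : Vec Kind n) u c →
      P * ∑ (allVecs p n) (λ x → boxIndicator κs x * ⟦ u ∙ x Fin.≟ c ⟧)
      ≡ boxCardinality κs - boxTransform κs u + P * boxTransform κs u * ⟦ 0# Fin.≟ c ⟧
    boxSpectrum [] [] c = lemma P ⟦ 0# Fin.≟ c ⟧
      where
      lemma : ∀ P d → P * (1ℤ * d + 0ℤ) ≡ 1ℤ - 1ℤ + P * 1ℤ * d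
      lemma = solve-∀
    boxSpectrum {ℕ.suc n} (κ ∷ κs) (a ∷ u) c = begin
      P * ∑ (allVecs p (ℕ.suc n)) (λ x → boxIndicator (κ ∷ κs) x * ⟦ (a ∷ u) ∙ x Fin.≟ c ⟧)
        ≡⟨ cong (P *_) (∑-allVecs-suc p n) ⟩
      P * ∑ (allFin p) (λ b → ∑ (allVecs p n) (λ x → ι b * boxIndicator κs x * ⟦ a *ᶠ b +ᶠ u ∙ x Fin.≟ c ⟧))
        ≡⟨ sym (∑-*ˡ P (allFin p)) ⟩
      ∑ (allFin p) (λ b → P * ∑ (allVecs p n) (λ x → ι b * boxIndicator κs x * ⟦ a *ᶠ b +ᶠ u ∙ x Fin.≟ c ⟧))
        ≡⟨ ∑-cong (allFin p) fibre ⟩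
      ∑ (allFin p) (λ b → (S - Ψ) * ι b + P * Ψ * (ι b * ⟦ a *ᶠ b Fin.≟ c ⟧))
        ≡⟨ ∑-+ (allFin p) ⟩
      ∑ (allFin p) (λ b → (S - Ψ) * ι b) + ∑ (allFin p) (λ b → P * Ψ * (ι b * ⟦ a *ᶠ b Fin.≟ c ⟧))
        ≡⟨ cong₂ _+_ (∑-*ˡ (S - Ψ) (allFin p)) (∑-*ˡ (P * Ψ) (allFin p)) ⟩
      (S - Ψ) * ∑ (allFin p) ι + P * Ψ * ∑ (allFin p) (λ b → ι b * ⟦ a *ᶠ b Fin.≟ c ⟧)
        ≡⟨ rearrange P S Ψ _ _ ⟩
      (S - Ψ) * ∑ (allFin p) ι + Ψ * (P * ∑ (allFin p) (λ b → ι b * ⟦ a *ᶠ b Fin.≟ c ⟧))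
        ≡⟨ cong₂ (λ s e → (S - Ψ) * s + Ψ * e) (∑-indicator κ) (spectrum κ a c) ⟩
      (S - Ψ) * s + Ψ * (s - ψ + P * ψ * ⟦ 0# Fin.≟ c ⟧)
        ≡⟨ combine P S Ψ s ψ ⟦ 0# Fin.≟ c ⟧ ⟩
      s * S - ψ * Ψ + P * (ψ * Ψ) * ⟦ 0# Fin.≟ c ⟧ ∎
      where
      open ≡-Reasoning
      ι : 𝔽 p → ℤ
      ι = indicator κ
      S Ψ s ψ : ℤ
      S = boxCardinality κs
      Ψ = boxTransform κs u
      s = cardinality κ
      ψ = transform κ a
      rearrange : ∀ P S Ψ x y → (S - Ψ) * x + P * Ψ * y ≡ (S - Ψ) * x + Ψ * (P * y)
      rearrange = solve-∀
      combine : ∀ P S Ψ s ψ d → (S - Ψ) * s + Ψ * (s - ψ + P * ψ * d) ≡ s * S - ψ * Ψ + P * (ψ * Ψ) * d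
      combine = solve-∀
      swap : ∀ P i x → P * (i * x) ≡ i * (P * x)
      swap = solve-∀
      expand : ∀ P i S Ψ d → i * (S - Ψ + P * Ψ * d) ≡ (S - Ψ) * i + P * Ψ * (i * d)
      expand = solve-∀
      fibre : ∀ b → P * ∑ (allVecs p n) (λ x → ι b * boxIndicator κs x * ⟦ a *ᶠ b +ᶠ u ∙ x Fin.≟ c ⟧)
                    ≡ (S - Ψ) * ι b + P * Ψ * (ι b * ⟦ a *ᶠ b Fin.≟ c ⟧)
      fibre b = begin
        P * ∑ (allVecs p n) (λ x → ι b * boxIndicator κs x * ⟦ a *ᶠ b +ᶠ u ∙ x Fin.≟ c ⟧)
          ≡⟨ cong (P *_) (∑-cong (allVecs p n) λ x → trans (ℤ.*-assoc (ι b) _ _)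
               (cong (λ z → ι b * (boxIndicator κs x * z))
                 (⟦⟧-cong (a *ᶠ b +ᶠ u ∙ x Fin.≟ c) (u ∙ x Fin.≟ c′) (shift⇒ _ _ c) (shift⇐ _ _ c)))) ⟩
        P * ∑ (allVecs p n) (λ x → ι b * (boxIndicator κs x * ⟦ u ∙ x Fin.≟ c′ ⟧))
          ≡⟨ cong (P *_) (∑-*ˡ (ι b) (allVecs p n)) ⟩
        P * (ι b * ∑ (allVecs p n) (λ x → boxIndicator κs x * ⟦ u ∙ x Fin.≟ c′ ⟧))
          ≡⟨ swap P (ι b) _ ⟩
        ι b * (P * ∑ (allVecs p n) (λ x → boxIndicator κs x * ⟦ u ∙ x Fin.≟ c′ ⟧))
          ≡⟨ cong (ι b *_) (boxSpectrum κs u c′) ⟩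
        ι b * (S - Ψ + P * Ψ * ⟦ 0# Fin.≟ c′ ⟧)
          ≡⟨ cong (λ d → ι b * (S - Ψ + P * Ψ * d))
               (⟦⟧-cong (0# Fin.≟ c′) (a *ᶠ b Fin.≟ c)
                 (λ eq → trans (sym (+-identityʳ _)) (shift⇐ _ 0# c eq))
                 (λ eq → shift⇒ _ 0# c (trans (+-identityʳ _) eq))) ⟩
        ι b * (S - Ψ + P * Ψ * ⟦ a *ᶠ b Fin.≟ c ⟧)
          ≡⟨ expand P (ι b) S Ψ _ ⟩
        (S - Ψ) * ι b + P * Ψ * (ι b * ⟦ a *ᶠ b Fin.≟ c ⟧) ∎
        where c′ = c +ᶠ -ᶠ (a *ᶠ b)

-- The order ideal as a union of two boxes

-- A property of all indices below m + q may be checked on the two blocks.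
∀-blocks : ∀ m {q} {Q : Pred (Fin (m ℕ.+ q)) 0ℓ} →
           (∀ i → Q (i ↑ˡ q)) → (∀ j → Q (m ↑ʳ j)) → ∀ i → Q i
∀-blocks ℕ.zero    l r i           = r i
∀-blocks (ℕ.suc m) l r Fin.zero    = l Fin.zero
∀-blocks (ℕ.suc m) l r (Fin.suc i) = ∀-blocks m (l ∘ Fin.suc) r i

lookup-ˡ : ∀ {A : Set} m {q} (k : A) (ys : Vec A q) i → lookup (replicate m k ++ ys) (i ↑ˡ q) ≡ k
lookup-ˡ m k ys i = trans (Vec.lookup-++ˡ (replicate m k) ys i) (Vec.lookup-replicate i k)

⟦⟧-⊎ : {A B : Set} (a? : Dec A) (b? : Dec B) →
       ⟦ a? ⊎-dec b? ⟧ ≡ ⟦ a? ⟧ + ⟦ b? ⟧ - ⟦ a? ×-dec b? ⟧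
⟦⟧-⊎ (yes _) (yes _) = refl
⟦⟧-⊎ (yes _) (no _)  = refl
⟦⟧-⊎ (no _)  b?      = lemma ⟦ b? ⟧
  where
  lemma : ∀ b → b ≡ 0ℤ + b - 0ℤ
  lemma = solve-∀

-- The subset of [m + q] corresponding to a subset of the last q indices.
shift : ∀ m {q} → Subset q → Subset (m ℕ.+ q)
shift m B = replicate m outside ++ B

∃-outside : ∀ {q} (B : Subset q) → ∣ B ∣ < q → ∃ λ j → lookup B j ≡ outside
∃-outside (outside ∷ B) _          = Fin.zero , refl
∃-outside (inside ∷ B)  (ℕ.s≤s lt) = let (j , eq) = ∃-outside B lt in Fin.suc j , eq

∃-inside : ∀ {q} (B : Subset q) → 1 ≤ ∣ B ∣ → ∃ λ j → lookup B j ≡ inside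
∃-inside (inside ∷ B)  _  = Fin.zero , refl
∃-inside (outside ∷ B) le = let (j , eq) = ∃-inside B le in Fin.suc j , eq

-- The coordinate sets of the box of vectors supported on a subset.
kindOf : Bool → Kind
kindOf inside  = full
kindOf outside = null

module Boxes (p : ℕ) .{{_ : NonZero p}} where
  open Field p
  open Spectrum p

  -- Membership of coordinate sets and of boxes.
  Allowed : Kind → 𝔽 p → Set
  Allowed full a = ⊤
  Allowed unit a = a ≢ 0#
  Allowed null a = a ≡ 0#

  allowed? : ∀ κ a → Dec (Allowed κ a)
  allowed? full a = yes tt
  allowed? unit a = ¬? (a Fin.≟ 0#)
  allowed? null a = a Fin.≟ 0#

  InBox : ∀ {n} → Vec Kind n → Vec (𝔽 p) n → Set
  InBox κs x = ∀ i → Allowed (lookup κs i) (lookup x i)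

  inBox? : ∀ {n} (κs : Vec Kind n) → Decidable (InBox κs)
  inBox? κs x = Fin.all? λ i → allowed? (lookup κs i) (lookup x i)

  indicator≡⟦⟧ : ∀ κ a → indicator κ a ≡ ⟦ allowed? κ a ⟧
  indicator≡⟦⟧ full a = refl
  indicator≡⟦⟧ unit a = sym (⟦⟧-¬ (a Fin.≟ 0#))
  indicator≡⟦⟧ null a = refl

  boxIndicator≡⟦⟧ : ∀ {n} (κs : Vec Kind n) x → boxIndicator κs x ≡ ⟦ inBox? κs x ⟧
  boxIndicator≡⟦⟧ []       []      = refl
  boxIndicator≡⟦⟧ (κ ∷ κs) (a ∷ x) = begin
    indicator κ a * boxIndicator κs x          ≡⟨ cong₂ _*_ (indicator≡⟦⟧ κ a) (boxIndicator≡⟦⟧ κs x) ⟩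
    ⟦ allowed? κ a ⟧ * ⟦ inBox? κs x ⟧         ≡⟨ ⟦⟧-× (allowed? κ a) (inBox? κs x) ⟨
    ⟦ allowed? κ a ×-dec inBox? κs x ⟧         ≡⟨ ⟦⟧-cong (allowed? κ a ×-dec inBox? κs x) (inBox? (κ ∷ κs) (a ∷ x)) join (λ h → h Fin.zero , h ∘ Fin.suc) ⟩
    ⟦ inBox? (κ ∷ κs) (a ∷ x) ⟧                ∎
    where
    open ≡-Reasoning
    join : Allowed κ a × InBox κs x → InBox (κ ∷ κs) (a ∷ x)
    join (h , _) Fin.zero    = h
    join (_ , t) (Fin.suc i) = t i

  boxIndicator-full : ∀ {n} (x : Vec (𝔽 p) n) → boxIndicator (replicate n full) x ≡ 1ℤ
  boxIndicator-full []      = refl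
  boxIndicator-full (a ∷ x) = cong (1ℤ *_) (boxIndicator-full x)

  boxCardinality-++ : ∀ {m n} (κs : Vec Kind m) (λs : Vec Kind n) →
    boxCardinality (κs ++ λs) ≡ boxCardinality κs * boxCardinality λs
  boxCardinality-++ []       λs = sym (ℤ.*-identityˡ _)
  boxCardinality-++ (κ ∷ κs) λs =
    trans (cong (cardinality κ *_) (boxCardinality-++ κs λs)) (sym (ℤ.*-assoc (cardinality κ) _ _))

  boxTransform-++ : ∀ {m n} (κs : Vec Kind m) (λs : Vec Kind n) x y →
    boxTransform (κs ++ λs) (x ++ y) ≡ boxTransform κs x * boxTransform λs y
  boxTransform-++ []       λs []      y = sym (ℤ.*-identityˡ _)
  boxTransform-++ (κ ∷ κs) λs (a ∷ x) y =
    trans (cong (transform κ a *_) (boxTransform-++ κs λs x y)) (sym (ℤ.*-assoc (transform κ a) _ _))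

  boxCardinality-replicate : ∀ n κ → boxCardinality (replicate n κ) ≡ cardinality κ ^ n
  boxCardinality-replicate ℕ.zero    κ = refl
  boxCardinality-replicate (ℕ.suc n) κ = cong (cardinality κ *_) (boxCardinality-replicate n κ)

  boxCardinality-null : ∀ n → boxCardinality (replicate n null) ≡ 1ℤ
  boxCardinality-null n = trans (boxCardinality-replicate n null) (ℤ.^-zeroˡ n)

  boxCardinality-subset : ∀ {n} (B : Subset n) → boxCardinality (Vec.map kindOf B) ≡ P ^ ∣ B ∣
  boxCardinality-subset []            = refl
  boxCardinality-subset (inside ∷ B)  = cong (P *_) (boxCardinality-subset B)
  boxCardinality-subset (outside ∷ B) = trans (ℤ.*-identityˡ _) (boxCardinality-subset B)

  boxTransform-null : ∀ {n} (y : Vec (𝔽 p) n) → boxTransform (replicate n null) y ≡ 1ℤ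
  boxTransform-null []      = refl
  boxTransform-null (a ∷ y) = cong (1ℤ *_) (boxTransform-null y)

  boxTransform-full : ∀ {n} (x : Vec (𝔽 p) n) → boxTransform (replicate n full) x ≡ P ^ n * ⟦ wt x ℕ.≟ 0 ⟧
  boxTransform-full []                = refl
  boxTransform-full {ℕ.suc n} (a ∷ x) with a Fin.≟ 0#
  ... | yes _ = trans (cong (P * 1ℤ *_) (boxTransform-full x)) (lemma P (P ^ n) ⟦ wt x ℕ.≟ 0 ⟧)
    where
    lemma : ∀ P Q d → P * 1ℤ * (Q * d) ≡ P * Q * d
    lemma = solve-∀
  ... | no  _ = lemma P (P ^ n) (boxTransform (replicate n full) x)
    where
    lemma : ∀ P Q x → P * 0ℤ * x ≡ P * Q * 0ℤ
    lemma = solve-∀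

  wt≤ : ∀ {n} (x : Vec (𝔽 p) n) → wt x ≤ n
  wt≤ x = Vec.count≤n (λ a → ¬? (a Fin.≟ 0#)) x

  wt≡0⇒ : ∀ {n} (x : Vec (𝔽 p) n) → wt x ≡ 0 → x ≡ 0ᵛ
  wt≡0⇒ []      _  = refl
  wt≡0⇒ (a ∷ x) eq with a Fin.≟ 0#
  ... | yes refl = cong (0# ∷_) (wt≡0⇒ x eq)

  -- The character sum at a vector of weight k over all vectors of length m
  -- with no zero entry.
  T : ℕ → ℕ → ℤ
  T m k = -1ℤ ^ k * (P - 1ℤ) ^ (m ∸ k)

  boxTransform-unit : ∀ {n} (x : Vec (𝔽 p) n) →
    boxTransform (replicate n unit) x ≡ T n (wt x)
  boxTransform-unit []                = refl
  boxTransform-unit {ℕ.suc n} (a ∷ x) with a Fin.≟ 0#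
  ... | yes _ = begin
    (P * 1ℤ - 1ℤ) * boxTransform (replicate n unit) x          ≡⟨ cong ((P * 1ℤ - 1ℤ) *_) (boxTransform-unit x) ⟩
    (P * 1ℤ - 1ℤ) * (-1ℤ ^ wt x * (P - 1ℤ) ^ (n ∸ wt x))       ≡⟨ lemma P (-1ℤ ^ wt x) ((P - 1ℤ) ^ (n ∸ wt x)) ⟩
    -1ℤ ^ wt x * (P - 1ℤ) ^ ℕ.suc (n ∸ wt x)                   ≡⟨ cong (λ e → -1ℤ ^ wt x * (P - 1ℤ) ^ e) (ℕ.+-∸-assoc 1 (wt≤ x)) ⟨
    -1ℤ ^ wt x * (P - 1ℤ) ^ (ℕ.suc n ∸ wt x)                   ∎
    where
    open ≡-Reasoning
    lemma : ∀ P s t → (P * 1ℤ - 1ℤ) * (s * t) ≡ s * ((P - 1ℤ) * t)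
    lemma = solve-∀
  ... | no  _ = trans (cong ((P * 0ℤ - 1ℤ) *_) (boxTransform-unit x)) (lemma P (-1ℤ ^ wt x) ((P - 1ℤ) ^ (n ∸ wt x)))
    where
    lemma : ∀ P s t → (P * 0ℤ - 1ℤ) * (s * t) ≡ -1ℤ * s * t
    lemma = solve-∀

  boxTransform-subset : ∀ {n} (B : Subset n) y →
    boxTransform (Vec.map kindOf B) y ≡ P ^ ∣ B ∣ * ⟦ vanishesOn? B y ⟧
  boxTransform-subset []            []      = refl
  boxTransform-subset (inside ∷ B)  (a ∷ y) = begin
    P * ⟦ a≟ ⟧ * boxTransform (Vec.map kindOf B) y         ≡⟨ cong (P * ⟦ a≟ ⟧ *_) (boxTransform-subset B y) ⟩
    P * ⟦ a≟ ⟧ * (P ^ ∣ B ∣ * ⟦ vanishesOn? B y ⟧)         ≡⟨ lemma P ⟦ a≟ ⟧ (P ^ ∣ B ∣) ⟦ vanishesOn? B y ⟧ ⟩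
    P * P ^ ∣ B ∣ * (⟦ a≟ ⟧ * ⟦ vanishesOn? B y ⟧)         ≡⟨ cong (P * P ^ ∣ B ∣ *_) (⟦⟧-× a≟ (vanishesOn? B y)) ⟨
    P * P ^ ∣ B ∣ * ⟦ a≟ ×-dec vanishesOn? B y ⟧           ≡⟨ cong (P * P ^ ∣ B ∣ *_) (⟦⟧-cong (a≟ ×-dec vanishesOn? B y) (vanishesOn? (inside ∷ B) (a ∷ y)) to from) ⟩
    P * P ^ ∣ B ∣ * ⟦ vanishesOn? (inside ∷ B) (a ∷ y) ⟧   ∎
    where
    open ≡-Reasoning
    a≟ = a Fin.≟ 0#
    lemma : ∀ P d Q e → P * d * (Q * e) ≡ P * Q * (d * e)
    lemma = solve-∀
    to : a ≡ 0# × VanishesOn B y → VanishesOn (inside ∷ B) (a ∷ y)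
    to (h , _) Fin.zero    _               = h
    to (_ , t) (Fin.suc i) (Vec.there i∈B) = t i i∈B
    from : VanishesOn (inside ∷ B) (a ∷ y) → a ≡ 0# × VanishesOn B y
    from h = h Fin.zero Vec.here , λ i i∈B → h (Fin.suc i) (Vec.there i∈B)
  boxTransform-subset (outside ∷ B) (a ∷ y) = begin
    1ℤ * boxTransform (Vec.map kindOf B) y               ≡⟨ ℤ.*-identityˡ _ ⟩
    boxTransform (Vec.map kindOf B) y                    ≡⟨ boxTransform-subset B y ⟩
    P ^ ∣ B ∣ * ⟦ vanishesOn? B y ⟧                      ≡⟨ cong (P ^ ∣ B ∣ *_) (⟦⟧-cong (vanishesOn? B y) (vanishesOn? (outside ∷ B) (a ∷ y)) to from) ⟩
    P ^ ∣ B ∣ * ⟦ vanishesOn? (outside ∷ B) (a ∷ y) ⟧    ∎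
    where
    open ≡-Reasoning
    to : VanishesOn B y → VanishesOn (outside ∷ B) (a ∷ y)
    to t (Fin.suc i) (Vec.there i∈B) = t i i∈B
    from : VanishesOn (outside ∷ B) (a ∷ y) → VanishesOn B y
    from h i i∈B = h (Fin.suc i) (Vec.there i∈B)

  ∈support⇒ : ∀ {n} (x : Vec (𝔽 p) n) i → i ∈ support x → lookup x i ≢ 0#
  ∈support⇒ (a ∷ x) Fin.zero    i∈ eq with a Fin.≟ 0#
  ∈support⇒ (a ∷ x) Fin.zero    () eq | yes _
  ... | no a≢0 = a≢0 eq
  ∈support⇒ (a ∷ x) (Fin.suc i) (Vec.there i∈) = ∈support⇒ x i i∈

  ∈support⇐ : ∀ {n} (x : Vec (𝔽 p) n) i → lookup x i ≢ 0# → i ∈ support x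
  ∈support⇐ (a ∷ x) Fin.zero    a≢0 with a Fin.≟ 0#
  ... | yes a≡0 = contradiction a≡0 a≢0
  ... | no _    = Vec.here
  ∈support⇐ (a ∷ x) (Fin.suc i) x≢0 = Vec.there (∈support⇐ x i x≢0)

  lookup-initialˡ : ∀ m {q} (i : Fin m) → lookup (initial m) (i ↑ˡ q) ≡ inside
  lookup-initialˡ m {q} i = trans (Vec.lookup∘tabulate _ (i ↑ˡ q))
    (dec-true (toℕ (i ↑ˡ q) ℕ.<? m) (subst (_< m) (sym (Fin.toℕ-↑ˡ i q)) (Fin.toℕ<n i)))

  lookup-initialʳ : ∀ m {q} (j : Fin q) → lookup (initial m) (m ↑ʳ j) ≡ outside
  lookup-initialʳ m {q} j = trans (Vec.lookup∘tabulate _ (m ↑ʳ j))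
    (dec-false (toℕ (m ↑ʳ j) ℕ.<? m) (subst (λ k → ¬ k < m) (sym (Fin.toℕ-↑ʳ m j)) (ℕ.≤⇒≯ (ℕ.m≤m+n m (toℕ j)))))

  initialˡ : ∀ m {q} (i : Fin m) → i ↑ˡ q ∈ initial m
  initialˡ m i = Vec.lookup⇒[]= _ _ (lookup-initialˡ m i)

  initialʳ : ∀ m {q} (j : Fin q) → m ↑ʳ j ∉ initial m
  initialʳ m j j∈ with trans (sym (lookup-initialʳ m j)) (Vec.[]=⇒lookup j∈)
  ... | ()

  lookup-fullIdeal : ∀ m {n} (B : Subset n) i →
    lookup (fullIdeal {p} m B) i ≡ (if lookup (initial m) i ∨ lookup B i then (p ∸ 1) mod p else 0#)
  lookup-fullIdeal m B i = trans (Vec.lookup-map i _ (initial m ∪ B))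
    (cong (λ s → if s then (p ∸ 1) mod p else 0#) (Vec.lookup-zipWith _∨_ i (initial m) B))

  lookup-fullIdealˡ : ∀ m {q} (B : Subset q) i → lookup (fullIdeal {p} m (shift m B)) (i ↑ˡ q) ≡ (p ∸ 1) mod p
  lookup-fullIdealˡ m B i = trans (lookup-fullIdeal m (shift m B) (i ↑ˡ _))
    (cong (λ s → if s ∨ lookup (shift m B) (i ↑ˡ _) then (p ∸ 1) mod p else 0#) (lookup-initialˡ m i))

  lookup-fullIdealʳ : ∀ m {q} (B : Subset q) j → lookup (fullIdeal {p} m (shift m B)) (m ↑ʳ j) ≡ (if lookup B j then (p ∸ 1) mod p else 0#)
  lookup-fullIdealʳ m B j = trans (lookup-fullIdeal m (shift m B) (m ↑ʳ j))
    (cong₂ (λ s t → if s ∨ t then (p ∸ 1) mod p else 0#) (lookup-initialʳ m j) (Vec.lookup-++ʳ (replicate m outside) B j))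

  ≤-top : ∀ (a : 𝔽 p) → a Fin.≤ (p ∸ 1) mod p
  ≤-top a = subst (toℕ a ≤_) (sym (trans toℕ-[ p ∸ 1 ] (m<n⇒m%n≡m (ℕ.∸-monoʳ-< {p} {1} {0} (ℕ.s≤s z≤n) (ℕ.>-nonZero⁻¹ p)))))
                    (ℕ.∸-monoˡ-≤ 1 (Fin.toℕ<n a))

  0≤ : ∀ {a : 𝔽 p} (b : 𝔽 p) → a ≡ 0# → a Fin.≤ b
  0≤ b refl = subst (_≤ toℕ b) (sym toℕ-0#) z≤n

  ≤0⇒≡0 : ∀ {a : 𝔽 p} → a Fin.≤ 0# {p} → a ≡ 0#
  ≤0⇒≡0 {a} a≤0 = Fin.toℕ-injective (trans (ℕ.n≤0⇒n≡0 (subst (toℕ a ≤_) toℕ-0# a≤0)) (sym toℕ-0#))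

  module _ (m : ℕ) {q : ℕ} (B : Subset q) where

    -- Among the ideals contained in I: those with support inside the bottom
    -- level, those with support containing the bottom level, and those with
    -- support equal to the bottom level.
    lowBox highBox commonBox : Vec Kind (m ℕ.+ q)
    lowBox    = replicate m full ++ replicate q null
    highBox   = replicate m unit ++ Vec.map kindOf B
    commonBox = replicate m unit ++ replicate q null

    -- The set I(GP).
    InIdeal : Pred (Vec (𝔽 p) (m ℕ.+ q)) 0ℓ
    InIdeal = IdealsWithin m (fullIdeal m (shift m B))

    inIdeal? : Decidable InIdeal
    inIdeal? = idealsWithin? m (fullIdeal m (shift m B))

    lookup-subsetʳ : ∀ {k} j → lookup (replicate m k ++ Vec.map kindOf B) (m ↑ʳ j) ≡ kindOf (lookup B j)
    lookup-subsetʳ {k} j = trans (Vec.lookup-++ʳ (replicate m k) _ j) (Vec.lookup-map j kindOf B)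

    lookup-nullʳ : ∀ {k} j → lookup (replicate m k ++ replicate q null) (m ↑ʳ j) ≡ null
    lookup-nullʳ {k} j = trans (Vec.lookup-++ʳ (replicate m k) _ j) (Vec.lookup-replicate j null)

    -- Membership of a box, given the kinds at the indices of the two blocks.
    box⁺ : ∀ {κ} {λs : Vec Kind q} {f : Fin q → Kind} → (∀ j → lookup (replicate m κ ++ λs) (m ↑ʳ j) ≡ f j) →
           ∀ z → (∀ i → Allowed κ (lookup z (i ↑ˡ q))) → (∀ j → Allowed (f j) (lookup z (m ↑ʳ j))) →
           InBox (replicate m κ ++ λs) z
    box⁺ {κ} {λs} eq z hˡ hʳ = ∀-blocks m
      (λ i → subst (λ k → Allowed k (lookup z (i ↑ˡ q))) (sym (lookup-ˡ m κ λs i)) (hˡ i))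
      (λ j → subst (λ k → Allowed k (lookup z (m ↑ʳ j))) (sym (eq j)) (hʳ j))

    boxˡ : ∀ {κ} {λs : Vec Kind q} z → InBox (replicate m κ ++ λs) z → ∀ i → Allowed κ (lookup z (i ↑ˡ q))
    boxˡ {κ} {λs} z h i = subst (λ k → Allowed k (lookup z (i ↑ˡ q))) (lookup-ˡ m κ λs i) (h (i ↑ˡ q))

    boxʳ : ∀ {κ} {λs : Vec Kind q} {f : Fin q → Kind} → (∀ j → lookup (replicate m κ ++ λs) (m ↑ʳ j) ≡ f j) →
           ∀ z → InBox (replicate m κ ++ λs) z → ∀ j → Allowed (f j) (lookup z (m ↑ʳ j))
    boxʳ eq z h j = subst (λ k → Allowed k (lookup z (m ↑ʳ j))) (eq j) (h (m ↑ʳ j))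

    common⁺ : ∀ z → InBox lowBox z × InBox highBox z → InBox commonBox z
    common⁺ z (low , high) = box⁺ lookup-nullʳ z (boxˡ z high) (boxʳ lookup-nullʳ z low)

    common⁻ : ∀ z → InBox commonBox z → InBox lowBox z × InBox highBox z
    common⁻ z com = box⁺ lookup-nullʳ z (λ _ → tt) zeros , box⁺ lookup-subsetʳ z (boxˡ z com) high
      where
      zeros : ∀ j → lookup z (m ↑ʳ j) ≡ 0#
      zeros = boxʳ lookup-nullʳ z com
      high : ∀ j → Allowed (kindOf (lookup B j)) (lookup z (m ↑ʳ j))
      high j with lookup B j
      ... | inside  = tt
      ... | outside = zeros j

    ideal⇒box : ∀ z → InIdeal z → InBox lowBox z ⊎ InBox highBox z
    ideal⇒box z (ideal , z⊑I) with Fin.any? (λ j → ¬? (lookup z (m ↑ʳ j) Fin.≟ 0#))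
    ... | yes (j , zj≢0) = inj₂ (box⁺ lookup-subsetʳ z units inB)
      where
      units : ∀ i → lookup z (i ↑ˡ q) ≢ 0#
      units i = ∈support⇒ z (i ↑ˡ q)
        (ideal (i ↑ˡ q) (m ↑ʳ j) (initialˡ m i , initialʳ m j) (∈support⇐ z (m ↑ʳ j) zj≢0))
      inB : ∀ j → Allowed (kindOf (lookup B j)) (lookup z (m ↑ʳ j))
      inB j with lookup B j in eq
      ... | inside  = tt
      ... | outside = ≤0⇒≡0 (subst (lookup z (m ↑ʳ j) Fin.≤_)
        (trans (lookup-fullIdealʳ m B j) (cong (λ s → if s then (p ∸ 1) mod p else 0#) eq))
        (Pointwise.lookup z⊑I (m ↑ʳ j)))
    ... | no none = inj₁ (box⁺ lookup-nullʳ z (λ _ → tt) zeros)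
      where
      zeros : ∀ j → lookup z (m ↑ʳ j) ≡ 0#
      zeros j with lookup z (m ↑ʳ j) Fin.≟ 0#
      ... | yes eq = eq
      ... | no  ne = contradiction (j , ne) none

    box⇒ideal : ∀ z → InBox lowBox z ⊎ InBox highBox z → InIdeal z
    box⇒ideal z (inj₁ low) = ideal , extensional⇒inductive (ext ⊑I)
      where
      zeros : ∀ j → lookup z (m ↑ʳ j) ≡ 0#
      zeros = boxʳ lookup-nullʳ z low
      ideal : IsUnsaturatedIdeal m z
      ideal i j (_ , j∉) j∈ = contradiction j∈ (∀-blocks m {Q = λ j → j ∉ initial m → j ∉ support z}
        (λ i i∉ → contradiction (initialˡ m i) i∉) (λ j _ j∈ → ∈support⇒ z (m ↑ʳ j) j∈ (zeros j)) j j∉)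
      ⊑I : ∀ i → lookup z i Fin.≤ lookup (fullIdeal m (shift m B)) i
      ⊑I = ∀-blocks m (λ i → subst (lookup z (i ↑ˡ q) Fin.≤_) (sym (lookup-fullIdealˡ m B i)) (≤-top _))
                      (λ j → 0≤ (lookup (fullIdeal m (shift m B)) (m ↑ʳ j)) (zeros j))
    box⇒ideal z (inj₂ high) = ideal , extensional⇒inductive (ext ⊑I)
      where
      ideal : IsUnsaturatedIdeal m z
      ideal i j (i∈ , _) _ = ∀-blocks m {Q = λ i → i ∈ initial m → i ∈ support z}
        (λ i _ → ∈support⇐ z (i ↑ˡ q) (boxˡ z high i))
        (λ j j∈ → contradiction j∈ (initialʳ m j)) i i∈
      inB : ∀ j → lookup z (m ↑ʳ j) Fin.≤ (if lookup B j then (p ∸ 1) mod p else 0#)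
      inB j with lookup B j | boxʳ lookup-subsetʳ z high j
      ... | inside  | _  = ≤-top _
      ... | outside | eq = 0≤ 0# eq
      ⊑I : ∀ i → lookup z i Fin.≤ lookup (fullIdeal m (shift m B)) i
      ⊑I = ∀-blocks m (λ i → subst (lookup z (i ↑ˡ q) Fin.≤_) (sym (lookup-fullIdealˡ m B i)) (≤-top _))
                      (λ j → subst (lookup z (m ↑ʳ j) Fin.≤_) (sym (lookup-fullIdealʳ m B j)) (inB j))

    -- The inclusion-exclusion combination of a function of boxes that
    -- corresponds to the complement of the ideal.
    complement : (Vec Kind (m ℕ.+ q) → ℤ) → ℤ
    complement f = f (replicate (m ℕ.+ q) full) - f lowBox - f highBox + f commonBox

    -- The defining set.
    D? : Decidable (DefiningSet p m (shift m B))
    D? = definingSet? p m (shift m B)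

    ⟦D⟧ : ∀ z → ⟦ D? z ⟧ ≡ complement (λ κs → boxIndicator κs z)
    ⟦D⟧ z = begin
      ⟦ D? z ⟧
        ≡⟨ ⟦⟧-¬ (inIdeal? z) ⟩
      1ℤ - ⟦ inIdeal? z ⟧
        ≡⟨ cong (_-_ 1ℤ) (⟦⟧-cong (inIdeal? z) (low? ⊎-dec high?) (ideal⇒box z) (box⇒ideal z)) ⟩
      1ℤ - ⟦ low? ⊎-dec high? ⟧
        ≡⟨ cong (_-_ 1ℤ) (⟦⟧-⊎ low? high?) ⟩
      1ℤ - (⟦ low? ⟧ + ⟦ high? ⟧ - ⟦ low? ×-dec high? ⟧)
        ≡⟨ cong (λ c → 1ℤ - (⟦ low? ⟧ + ⟦ high? ⟧ - c)) (⟦⟧-cong (low? ×-dec high?) (inBox? commonBox z) (common⁺ z) (common⁻ z)) ⟩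
      1ℤ - (⟦ low? ⟧ + ⟦ high? ⟧ - ⟦ inBox? commonBox z ⟧)
        ≡⟨ rearrange 1ℤ ⟦ low? ⟧ ⟦ high? ⟧ ⟦ inBox? commonBox z ⟧ ⟩
      1ℤ - ⟦ low? ⟧ - ⟦ high? ⟧ + ⟦ inBox? commonBox z ⟧
        ≡⟨ cong₂ _+_ (cong₂ _-_ (cong₂ _-_ (sym (boxIndicator-full z)) (sym (boxIndicator≡⟦⟧ lowBox z)))
                                (sym (boxIndicator≡⟦⟧ highBox z))) (sym (boxIndicator≡⟦⟧ commonBox z)) ⟩
      complement (λ κs → boxIndicator κs z) ∎
      where
      open ≡-Reasoning
      low?  = inBox? lowBox z
      high? = inBox? highBox z
      rearrange : ∀ o a b c → o - (a + b - c) ≡ o - a - b + c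
      rearrange = solve-∀

    ∑-D : ∀ (g : Vec (𝔽 p) (m ℕ.+ q) → ℤ) →
      ∑ (allVecs p (m ℕ.+ q)) (λ z → ⟦ D? z ⟧ * g z)
      ≡ complement (λ κs → ∑ (allVecs p (m ℕ.+ q)) (λ z → boxIndicator κs z * g z))
    ∑-D g = begin
      ∑ V (λ z → ⟦ D? z ⟧ * g z)
        ≡⟨ ∑-cong V (λ z → trans (cong (_* g z) (⟦D⟧ z))
             (distrib (boxIndicator (replicate (m ℕ.+ q) full) z) (boxIndicator lowBox z) (boxIndicator highBox z) (boxIndicator commonBox z) (g z))) ⟩
      ∑ V (λ z → complement (λ κs → boxIndicator κs z * g z))
        ≡⟨ ∑-+ V ⟩
      ∑ V (λ z → f (replicate (m ℕ.+ q) full) z - f lowBox z - f highBox z) + ∑ V (f commonBox)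
        ≡⟨ cong (_+ ∑ V (f commonBox)) (trans (∑-- V) (cong (_- ∑ V (f highBox)) (∑-- V))) ⟩
      complement (λ κs → ∑ V (f κs)) ∎
      where
      open ≡-Reasoning
      V = allVecs p (m ℕ.+ q)
      f : Vec Kind (m ℕ.+ q) → Vec (𝔽 p) (m ℕ.+ q) → ℤ
      f κs z = boxIndicator κs z * g z
      distrib : ∀ a b c d g → (a - b - c + d) * g ≡ a * g - b * g - c * g + d * g
      distrib = solve-∀

    complement-cong : ∀ {f g} → (∀ κs → f κs ≡ g κs) → complement f ≡ complement g
    complement-cong eq = cong₂ _+_ (cong₂ _-_ (cong₂ _-_ (eq _) (eq _)) (eq _)) (eq _)

    size-D≡complement : + size D? ≡ complement boxCardinality
    size-D≡complement = begin
      + size D?                                                  ≡⟨ size≡∑ D? ⟩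
      ∑ (allVecs p (m ℕ.+ q)) (λ z → ⟦ D? z ⟧)                   ≡⟨ ∑-cong (allVecs p (m ℕ.+ q)) (λ z → sym (ℤ.*-identityʳ _)) ⟩
      ∑ (allVecs p (m ℕ.+ q)) (λ z → ⟦ D? z ⟧ * 1ℤ)              ≡⟨ ∑-D (λ _ → 1ℤ) ⟩
      complement (λ κs → ∑ (allVecs p (m ℕ.+ q)) (λ z → boxIndicator κs z * 1ℤ))
        ≡⟨ complement-cong (λ κs → trans (∑-cong (allVecs p (m ℕ.+ q)) λ z → ℤ.*-identityʳ _) (∑-boxIndicator κs)) ⟩
      complement boxCardinality                                  ∎
      where open ≡-Reasoning

    size-D : + size D? ≡ P ^ (m ℕ.+ q) - P ^ m - (P - 1ℤ) ^ m * (P ^ ∣ B ∣ - 1ℤ)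
    size-D = begin
      + size D?
        ≡⟨ size-D≡complement ⟩
      complement boxCardinality
        ≡⟨ cong₂ _+_ (cong₂ _-_ (cong₂ _-_ (boxCardinality-replicate (m ℕ.+ q) full)
             (block (replicate m full) (replicate q null) (boxCardinality-replicate m full) (boxCardinality-null q)))
             (block (replicate m unit) (Vec.map kindOf B) (boxCardinality-replicate m unit) (boxCardinality-subset B)))
             (block (replicate m unit) (replicate q null) (boxCardinality-replicate m unit) (boxCardinality-null q)) ⟩
      P ^ (m ℕ.+ q) - P ^ m * 1ℤ - (P - 1ℤ) ^ m * P ^ ∣ B ∣ + (P - 1ℤ) ^ m * 1ℤ
        ≡⟨ lemma (P ^ (m ℕ.+ q)) (P ^ m) ((P - 1ℤ) ^ m) (P ^ ∣ B ∣) ⟩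
      P ^ (m ℕ.+ q) - P ^ m - (P - 1ℤ) ^ m * (P ^ ∣ B ∣ - 1ℤ) ∎
      where
      open ≡-Reasoning
      block : ∀ {a b} (κs : Vec Kind m) (λs : Vec Kind q) → boxCardinality κs ≡ a → boxCardinality λs ≡ b →
              boxCardinality (κs ++ λs) ≡ a * b
      block κs λs eq eq′ = trans (boxCardinality-++ κs λs) (cong₂ _*_ eq eq′)
      lemma : ∀ N M U b → N - M * 1ℤ - U * b + U * 1ℤ ≡ N - M - U * (b - 1ℤ)
      lemma = solve-∀

    vanishes-shift : ∀ x y → ⟦ vanishesOn? B y ⟧ ≡ + δ (shift m B) (x ++ y)
    vanishes-shift x y = ⟦⟧-cong (vanishesOn? B y) (vanishesOn? (shift m B) (x ++ y)) to from
      where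
      to : VanishesOn B y → VanishesOn (shift m B) (x ++ y)
      to h = ∀-blocks m
        (λ i i∈ → contradiction (trans (sym (Vec.[]=⇒lookup i∈)) (lookup-ˡ m outside B i)) λ ())
        (λ j j∈ → trans (Vec.lookup-++ʳ x y j)
          (h j (Vec.lookup⇒[]= j B (trans (sym (Vec.lookup-++ʳ (replicate m outside) B j)) (Vec.[]=⇒lookup j∈)))))
      from : VanishesOn (shift m B) (x ++ y) → VanishesOn B y
      from h j j∈ = trans (sym (Vec.lookup-++ʳ x y j))
        (h (m ↑ʳ j) (Vec.lookup⇒[]= _ _ (trans (Vec.lookup-++ʳ (replicate m outside) B j) (Vec.[]=⇒lookup j∈))))

    transform-D : ∀ x y → x ++ y ≢ 0ᵛ →
      complement (λ κs → boxTransform κs (x ++ y))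
      ≡ ℤ.- (P ^ m * ⟦ wt x ℕ.≟ 0 ⟧ + T m (wt x) * (P ^ ∣ B ∣ * + δ (shift m B) (x ++ y) - 1ℤ))
    transform-D x y u≢0 = begin
      complement (λ κs → boxTransform κs (x ++ y))
        ≡⟨ cong₂ _+_ (cong₂ _-_ (cong₂ _-_
             (trans (boxTransform-full (x ++ y)) (cong (P ^ (m ℕ.+ q) *_) (⟦⟧-no (wt (x ++ y) ℕ.≟ 0) (u≢0 ∘ wt≡0⇒ (x ++ y)))))
             (block (replicate m full) (replicate q null) (boxTransform-full x) (boxTransform-null y)))
             (block (replicate m unit) (Vec.map kindOf B) (boxTransform-unit x) (trans (boxTransform-subset B y) (cong (P ^ ∣ B ∣ *_) (vanishes-shift x y)))))
             (block (replicate m unit) (replicate q null) (boxTransform-unit x) (boxTransform-null y)) ⟩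
      P ^ (m ℕ.+ q) * 0ℤ - P ^ m * ⟦ wt x ℕ.≟ 0 ⟧ * 1ℤ - T m (wt x) * (P ^ ∣ B ∣ * + δ (shift m B) (x ++ y)) + T m (wt x) * 1ℤ
        ≡⟨ lemma (P ^ (m ℕ.+ q)) (P ^ m * ⟦ wt x ℕ.≟ 0 ⟧) (T m (wt x)) (P ^ ∣ B ∣ * + δ (shift m B) (x ++ y)) ⟩
      ℤ.- (P ^ m * ⟦ wt x ℕ.≟ 0 ⟧ + T m (wt x) * (P ^ ∣ B ∣ * + δ (shift m B) (x ++ y) - 1ℤ)) ∎
      where
      open ≡-Reasoning
      block : ∀ {a b} (κs : Vec Kind m) (λs : Vec Kind q) → boxTransform κs x ≡ a → boxTransform λs y ≡ b →
              boxTransform (κs ++ λs) (x ++ y) ≡ a * b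
      block κs λs eq eq′ = trans (boxTransform-++ κs λs x y) (cong₂ _*_ eq eq′)
      lemma : ∀ N M T e → N * 0ℤ - M * 1ℤ - T * e + T * 1ℤ ≡ ℤ.- (M + T * (e - 1ℤ))
      lemma = solve-∀

    module _ (prime : Prime p) where

      -- A coordinate of the codeword of u is zero at the x in D with
      -- u . x = 0, and the spectrum of the four boxes counts these.
      P*wt≡ : ∀ u → P * + wt (codeword D? u)
                    ≡ (P - 1ℤ) * (+ size D? - complement (λ κs → boxTransform κs u))
      P*wt≡ u = begin
        P * + wt (codeword D? u)
          ≡⟨ cong (P *_) (wt-codeword≡∑ D? u) ⟩
        P * ∑ V (λ z → ⟦ D? z ⟧ * (1ℤ - e z))
          ≡⟨ cong (P *_) (trans (∑-cong V λ z → distrib ⟦ D? z ⟧ (e z)) (∑-- V)) ⟩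
        P * (∑ V (λ z → ⟦ D? z ⟧) - ∑ V (λ z → ⟦ D? z ⟧ * e z))
          ≡⟨ cong (P *_) (cong₂ _-_ (sym (size≡∑ D?)) (∑-D e)) ⟩
        P * (+ size D? - complement (λ κs → Z κs))
          ≡⟨ distrib₂ P (+ size D?) (Z (replicate (m ℕ.+ q) full)) (Z lowBox) (Z highBox) (Z commonBox) ⟩
        P * + size D? - complement (λ κs → P * Z κs)
          ≡⟨ cong (_-_ (P * + size D?)) (complement-cong λ κs → trans (boxSpectrum prime κs u 0#)
               (cong (λ d → boxCardinality κs - boxTransform κs u + P * boxTransform κs u * d) (⟦⟧-yes (0# {p} Fin.≟ 0#) refl))) ⟩
        P * + size D? - complement (λ κs → boxCardinality κs - boxTransform κs u + P * boxTransform κs u * 1ℤ)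
          ≡⟨ cong (_-_ (P * + size D?)) (separate P (S (replicate (m ℕ.+ q) full)) (S lowBox) (S highBox) (S commonBox) (Ψ (replicate (m ℕ.+ q) full)) (Ψ lowBox) (Ψ highBox) (Ψ commonBox)) ⟩
        P * + size D? - (complement S + (P - 1ℤ) * complement Ψ)
          ≡⟨ cong (λ s → P * + size D? - (s + (P - 1ℤ) * complement Ψ)) (sym size-D≡complement) ⟩
        P * + size D? - (+ size D? + (P - 1ℤ) * complement Ψ)
          ≡⟨ final P (+ size D?) (complement Ψ) ⟩
        (P - 1ℤ) * (+ size D? - complement Ψ) ∎
        where
        open ≡-Reasoning
        V = allVecs p (m ℕ.+ q)
        e : Vec (𝔽 p) (m ℕ.+ q) → ℤ
        e z = ⟦ u ∙ z Fin.≟ 0# ⟧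
        Z S Ψ : Vec Kind (m ℕ.+ q) → ℤ
        Z κs = ∑ V (λ z → boxIndicator κs z * e z)
        S = boxCardinality
        Ψ κs = boxTransform κs u
        distrib : ∀ d e → d * (1ℤ - e) ≡ d - d * e
        distrib = solve-∀
        distrib₂ : ∀ P s a b c d → P * (s - (a - b - c + d)) ≡ P * s - (P * a - P * b - P * c + P * d)
        distrib₂ = solve-∀
        separate : ∀ P a b c d a′ b′ c′ d′ →
          (a - a′ + P * a′ * 1ℤ) - (b - b′ + P * b′ * 1ℤ) - (c - c′ + P * c′ * 1ℤ) + (d - d′ + P * d′ * 1ℤ)
          ≡ (a - b - c + d) + (P - 1ℤ) * (a′ - b′ - c′ + d′)
        separate = solve-∀
        final : ∀ P s t → P * s - (s + (P - 1ℤ) * t) ≡ (P - 1ℤ) * (s - t)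
        final = solve-∀

      weight-formula : ∀ x y → x ++ y ≢ 0ᵛ →
        P * + wt (codeword D? (x ++ y))
        ≡ (P - 1ℤ) * (+ size D? + P ^ m * ⟦ wt x ℕ.≟ 0 ⟧ + T m (wt x) * (P ^ ∣ B ∣ * + δ (shift m B) (x ++ y) - 1ℤ))
      weight-formula x y u≢0 = trans (P*wt≡ (x ++ y)) (cong ((P - 1ℤ) *_)
        (trans (cong (_-_ (+ size D?)) (transform-D x y u≢0)) (lemma (+ size D?) (P ^ m * ⟦ wt x ℕ.≟ 0 ⟧) (T m (wt x) * (P ^ ∣ B ∣ * + δ (shift m B) (x ++ y) - 1ℤ)))))
        where
        lemma : ∀ s a b → s - ℤ.- (a + b) ≡ s + a + b
        lemma = solve-∀

-- Linear maps and codes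

module Linear (p : ℕ) .{{_ : NonZero p}} where
  open Field p
  open Boxes p

  ∙-+ˡ : ∀ {n} (u v x : Vec (𝔽 p) n) → (u +ᵛ v) ∙ x ≡ u ∙ x +ᶠ v ∙ x
  ∙-+ˡ []      []      []      = sym (+-identityʳ 0#)
  ∙-+ˡ (a ∷ u) (b ∷ v) (c ∷ x) =
    trans (cong₂ _+ᶠ_ (distribʳ c a b) (∙-+ˡ u v x)) (+ᶠ-interchange (a *ᶠ c) (b *ᶠ c) (u ∙ x) (v ∙ x))

  ∙-*ˡ : ∀ {n} a (u x : Vec (𝔽 p) n) → (a *ᵛ u) ∙ x ≡ a *ᶠ (u ∙ x)
  ∙-*ˡ a []      []      = sym (zeroʳ a)
  ∙-*ˡ a (b ∷ u) (c ∷ x) =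
    trans (cong₂ _+ᶠ_ (*ᶠ-assoc a b c) (∙-*ˡ a u x)) (sym (*ᶠ-distribˡ-+ᶠ a (b *ᶠ c) (u ∙ x)))

  ∙-0ˡ : ∀ {n} (x : Vec (𝔽 p) n) → 0ᵛ ∙ x ≡ 0#
  ∙-0ˡ []      = refl
  ∙-0ˡ (c ∷ x) = trans (cong₂ _+ᶠ_ (zeroˡ c) (∙-0ˡ x)) (+-identityʳ 0#)

  ∙-comm : ∀ {n} (u x : Vec (𝔽 p) n) → u ∙ x ≡ x ∙ u
  ∙-comm []      []      = refl
  ∙-comm (a ∷ u) (c ∷ x) = cong₂ _+ᶠ_ (*ᶠ-comm a c) (∙-comm u x)

  ∙-+ʳ : ∀ {n} (u x y : Vec (𝔽 p) n) → u ∙ (x +ᵛ y) ≡ u ∙ x +ᶠ u ∙ y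
  ∙-+ʳ u x y = trans (∙-comm u (x +ᵛ y)) (trans (∙-+ˡ x y u) (cong₂ _+ᶠ_ (∙-comm x u) (∙-comm y u)))

  ∙-basisVector : ∀ {n} (u : Vec (𝔽 p) n) i → u ∙ basisVector i ≡ lookup u i
  ∙-basisVector (a ∷ u) Fin.zero    =
    trans (cong₂ _+ᶠ_ (*-identityʳ a) (trans (∙-comm u 0ᵛ) (∙-0ˡ u))) (+-identityʳ a)
  ∙-basisVector (a ∷ u) (Fin.suc i) =
    trans (cong₂ _+ᶠ_ (zeroʳ a) (∙-basisVector u i)) (+ᶠ-identityˡ _)

  lookup-basisVector-≡ : ∀ {n} (i : Fin n) → lookup (basisVector i) i ≡ 1# {p}
  lookup-basisVector-≡ i = Vec.lookup∘update i 0ᵛ 1#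

  lookup-basisVector-≢ : ∀ {n} {i j : Fin n} → i ≢ j → lookup (basisVector j) i ≡ 0# {p}
  lookup-basisVector-≢ {i = i} i≢j = trans (Vec.lookup∘update′ i≢j 0ᵛ 1#) (Vec.lookup-replicate i 0#)

  +ᵛ-identityˡ : ∀ {n} (x : Vec (𝔽 p) n) → 0ᵛ +ᵛ x ≡ x
  +ᵛ-identityˡ []      = refl
  +ᵛ-identityˡ (a ∷ x) = cong₂ _∷_ (+ᶠ-identityˡ a) (+ᵛ-identityˡ x)

  +ᵛ-identityʳ : ∀ {n} (x : Vec (𝔽 p) n) → x +ᵛ 0ᵛ ≡ x
  +ᵛ-identityʳ []      = refl
  +ᵛ-identityʳ (a ∷ x) = cong₂ _∷_ (+-identityʳ a) (+ᵛ-identityʳ x)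

  *ᵛ-zeroʳ : ∀ {n} a → a *ᵛ 0ᵛ {n = n} ≡ 0ᵛ
  *ᵛ-zeroʳ {n} a = trans (Vec.map-replicate (a *ᶠ_) 0# n) (cong (replicate n) (zeroʳ a))

  record IsLinearMap {k N : ℕ} (f : Vec (𝔽 p) k → Vec (𝔽 p) N) : Set where
    field
      0-homo : f 0ᵛ ≡ 0ᵛ
      +-homo : ∀ x y → f (x +ᵛ y) ≡ f x +ᵛ f y
      *-homo : ∀ a x → f (a *ᵛ x) ≡ a *ᵛ f x

  ∘-isLinearMap : ∀ {k l N} {f : Vec (𝔽 p) l → Vec (𝔽 p) N} {g : Vec (𝔽 p) k → Vec (𝔽 p) l} →
                  IsLinearMap f → IsLinearMap g → IsLinearMap (f ∘ g)
  ∘-isLinearMap {f = f} F G = record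
    { 0-homo = trans (cong f (IsLinearMap.0-homo G)) (IsLinearMap.0-homo F)
    ; +-homo = λ x y → trans (cong f (IsLinearMap.+-homo G x y)) (IsLinearMap.+-homo F _ _)
    ; *-homo = λ a x → trans (cong f (IsLinearMap.*-homo G a x)) (IsLinearMap.*-homo F a _) }

  0∷-isLinearMap : ∀ {n} → IsLinearMap {n} (0# ∷_)
  0∷-isLinearMap = record
    { 0-homo = refl
    ; +-homo = λ x y → cong (_∷ (x +ᵛ y)) (sym (+-identityʳ 0#))
    ; *-homo = λ a x → cong (_∷ (a *ᵛ x)) (sym (zeroʳ a)) }

  combination-map : ∀ {k l N} {f : Vec (𝔽 p) l → Vec (𝔽 p) N} → IsLinearMap f →
    ∀ (a : Vec (𝔽 p) k) g → combination a (Vec.map f g) ≡ f (combination a g)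
  combination-map F []      []      = sym (IsLinearMap.0-homo F)
  combination-map F (a ∷ as) (g ∷ gs) = trans
    (cong₂ _+ᵛ_ (sym (IsLinearMap.*-homo F a g)) (combination-map F as gs))
    (sym (IsLinearMap.+-homo F _ _))

  standardBasis : ∀ n → Vec (Vec (𝔽 p) n) n
  standardBasis ℕ.zero    = []
  standardBasis (ℕ.suc n) = (1# ∷ 0ᵛ) ∷ Vec.map (0# ∷_) (standardBasis n)

  combination-standardBasis : ∀ {n} (a : Vec (𝔽 p) n) → combination a (standardBasis n) ≡ a
  combination-standardBasis []       = refl
  combination-standardBasis (a ∷ as) = begin
    (a *ᶠ 1# ∷ a *ᵛ 0ᵛ) +ᵛ combination as (Vec.map (0# ∷_) (standardBasis _))
      ≡⟨ cong₂ _+ᵛ_ (cong₂ _∷_ (*-identityʳ a) (*ᵛ-zeroʳ a))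
           (trans (combination-map 0∷-isLinearMap as _) (cong (0# ∷_) (combination-standardBasis as))) ⟩
    (a ∷ 0ᵛ) +ᵛ (0# ∷ as)
      ≡⟨ cong₂ _∷_ (+-identityʳ a) (+ᵛ-identityˡ as) ⟩
    a ∷ as ∎
    where open ≡-Reasoning

  -- The image of an injective linear map on a k-dimensional space is a
  -- k-dimensional code, with the images of the unit vectors as a basis.
  image-hasDimension : ∀ {k N} {K : Code p N} {f : Vec (𝔽 p) k → Vec (𝔽 p) N} → IsLinearMap f →
    (∀ a → K (f a)) → (∀ {c} → K c → ∃ λ a → c ≡ f a) → (∀ a → f a ≡ 0ᵛ → a ≡ 0ᵛ) → HasDimension K k
  image-hasDimension {k} {N} {K} {f} F image preimage injective = record
    { linear  = record
      { 0-mem    = subst K 0-homo (image 0ᵛ)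
      ; +-closed = λ Kx Ky → +-closed (preimage Kx) (preimage Ky)
      ; *-closed = λ a Kx → *-closed a (preimage Kx) }
    ; basis   = Vec.map f (standardBasis k)
    ; isBasis = record
      { members     = members (standardBasis k)
      ; independent = λ a eq → injective a (trans (sym (combination≡f a)) eq)
      ; spanning    = λ Kx → let (a , eq) = preimage Kx in a , trans eq (sym (combination≡f a)) } }
    where
    open IsLinearMap F
    +-closed : ∀ {x y} → (∃ λ a → x ≡ f a) → (∃ λ a → y ≡ f a) → K (x +ᵛ y)
    +-closed (a , refl) (b , refl) = subst K (+-homo a b) (image (a +ᵛ b))
    *-closed : ∀ c {x} → (∃ λ a → x ≡ f a) → K (c *ᵛ x)
    *-closed c (a , refl) = subst K (*-homo c a) (image (c *ᵛ a))
    members : ∀ {l} (gs : Vec (Vec (𝔽 p) k) l) → Allᵛ K (Vec.map f gs)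
    members []       = []
    members (g ∷ gs) = image g ∷ members gs
    combination≡f : ∀ a → combination a (Vec.map f (standardBasis k)) ≡ f a
    combination≡f a = trans (combination-map F a (standardBasis k)) (cong f (combination-standardBasis a))

  codeword-isLinearMap : ∀ {n} {D : Pred (Vec (𝔽 p) n) 0ℓ} (D? : Decidable D) → IsLinearMap (codeword D?)
  codeword-isLinearMap {n} D? = record
    { 0-homo = 0-homo xs ; +-homo = λ u v → +-homo u v xs ; *-homo = λ a u → *-homo a u xs }
    where
    xs = Vec.fromList (elements D?)
    0-homo : ∀ {N} (xs : Vec (Vec (𝔽 p) n) N) → Vec.map (0ᵛ ∙_) xs ≡ 0ᵛ
    0-homo []       = refl
    0-homo (x ∷ xs) = cong₂ _∷_ (∙-0ˡ x) (0-homo xs)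
    +-homo : ∀ u v {N} (xs : Vec (Vec (𝔽 p) n) N) → Vec.map ((u +ᵛ v) ∙_) xs ≡ Vec.map (u ∙_) xs +ᵛ Vec.map (v ∙_) xs
    +-homo u v []       = refl
    +-homo u v (x ∷ xs) = cong₂ _∷_ (∙-+ˡ u v x) (+-homo u v xs)
    *-homo : ∀ a u {N} (xs : Vec (Vec (𝔽 p) n) N) → Vec.map ((a *ᵛ u) ∙_) xs ≡ a *ᵛ Vec.map (u ∙_) xs
    *-homo a u []       = refl
    *-homo a u (x ∷ xs) = cong₂ _∷_ (∙-*ˡ a u x) (*-homo a u xs)

  codeword≡0⇒ : ∀ {n} {D : Pred (Vec (𝔽 p) n) 0ℓ} (D? : Decidable D) u → codeword D? u ≡ 0ᵛ →
                ∀ {x} → D x → u ∙ x ≡ 0#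
  codeword≡0⇒ D? u eq {x} Dx = go (elements D?) eq (∈-filter⁺ D? (∈-allVecs x) Dx)
    where
    go : ∀ xs → Vec.map (u ∙_) (Vec.fromList xs) ≡ 0ᵛ → x ∈ˡ xs → u ∙ x ≡ 0#
    go (y ∷ xs) eq (here refl)  = Vec.∷-injectiveˡ eq
    go (y ∷ xs) eq (there x∈xs) = go xs (Vec.∷-injectiveʳ eq) x∈xs

  codeword≡0⇐ : ∀ {n} {D : Pred (Vec (𝔽 p) n) 0ℓ} (D? : Decidable D) u →
                (∀ x → D x → u ∙ x ≡ 0#) → codeword D? u ≡ 0ᵛ
  codeword≡0⇐ {n} D? u h = go (elements D?) λ x x∈ → h x (proj₂ (∈-filter⁻ D? {xs = allVecs p n} x∈))
    where
    go : ∀ xs → (∀ x → x ∈ˡ xs → u ∙ x ≡ 0#) → Vec.map (u ∙_) (Vec.fromList xs) ≡ 0ᵛ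
    go []       h = refl
    go (y ∷ xs) h = cong₂ _∷_ (h y (here refl)) (go xs λ x → h x ∘ there)

  wt-0ᵛ : ∀ n → wt (0ᵛ {p} {n}) ≡ 0
  wt-0ᵛ ℕ.zero    = refl
  wt-0ᵛ (ℕ.suc n) with 0# {p} Fin.≟ 0#
  ... | yes _ = wt-0ᵛ n
  ... | no ¬e = contradiction refl ¬e

  -1ᶠ : 𝔽 p
  -1ᶠ = -ᶠ 1#

  -1*≡- : ∀ a → -1ᶠ *ᶠ a ≡ -ᶠ a
  -1*≡- a = trans (sym (-‿distribˡ-* 1# a)) (cong -ᶠ_ (*ᶠ-identityˡ a))

  dist≡wt : ∀ {n} (x y : Vec (𝔽 p) n) → dist x y ≡ wt (x +ᵛ -1ᶠ *ᵛ y)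
  dist≡wt []      []      = refl
  dist≡wt (a ∷ x) (b ∷ y) with a Fin.≟ b | a +ᶠ -1ᶠ *ᶠ b Fin.≟ 0#
  ... | yes _   | yes _  = dist≡wt x y
  ... | no _    | no _   = cong ℕ.suc (dist≡wt x y)
  ... | yes refl | no ne = contradiction (trans (cong (a +ᶠ_) (-1*≡- a)) (-‿inverseʳ a)) ne
  ... | no ne   | yes eq = contradiction a≡b ne
    where
    open ≡-Reasoning
    a≡b : a ≡ b
    a≡b = begin
      a                       ≡⟨ +-identityʳ a ⟨
      a +ᶠ 0#                 ≡⟨ cong (a +ᶠ_) (-ᶠ-inverseˡ b) ⟨
      a +ᶠ (-ᶠ b +ᶠ b)        ≡⟨ +ᶠ-assoc a (-ᶠ b) b ⟨
      a +ᶠ -ᶠ b +ᶠ b          ≡⟨ cong (λ z → a +ᶠ z +ᶠ b) (-1*≡- b) ⟨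
      a +ᶠ -1ᶠ *ᶠ b +ᶠ b      ≡⟨ cong (_+ᶠ b) eq ⟩
      0# +ᶠ b                 ≡⟨ +ᶠ-identityˡ b ⟩
      b                       ∎

  dist≡0⇒≡ : ∀ {N} (x y : Vec (𝔽 p) N) → dist x y ≡ 0 → x ≡ y
  dist≡0⇒≡ []      []      _ = refl
  dist≡0⇒≡ (a ∷ x) (b ∷ y) eq with a Fin.≟ b
  ... | yes refl = cong (a ∷_) (dist≡0⇒≡ x y eq)

  ≡0ᵛ : ∀ {n} (z : Vec (𝔽 p) n) → (∀ i → lookup z i ≡ 0#) → z ≡ 0ᵛ
  ≡0ᵛ []      _ = refl
  ≡0ᵛ (a ∷ z) h = cong₂ _∷_ (h Fin.zero) (≡0ᵛ z (h ∘ Fin.suc))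

  module _ (m : ℕ) {q : ℕ} (B : Subset q) where

    -- A vector lies outside the ideal if it is nonzero at some upper
    -- coordinate and either that coordinate is not in B or some lower
    -- coordinate is zero.
    D⁺ : ∀ {z} j → lookup z (m ↑ʳ j) ≢ 0# →
         lookup B j ≡ outside ⊎ (∃ λ i → lookup z (i ↑ˡ q) ≡ 0#) →
         DefiningSet p m (shift m B) z
    D⁺ {z} j zj≢0 h z∈ = [ zj≢0 ∘ (λ low → boxʳ m B (lookup-nullʳ m B) z low j) , notHigh h ]′ (ideal⇒box m B z z∈)
      where
      notHigh : lookup B j ≡ outside ⊎ (∃ λ i → lookup z (i ↑ˡ q) ≡ 0#) → ¬ InBox (highBox m B) z
      notHigh (inj₁ eq) high = zj≢0 (subst (λ s → Allowed (kindOf s) (lookup z (m ↑ʳ j))) eq (boxʳ m B (lookup-subsetʳ m B) z high j))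
      notHigh (inj₂ (i , eq)) high = boxˡ m B z high i eq

    -- Outside the degenerate case, D contains a unit vector and its sums
    -- with all the others, so that D spans the whole space.
    codeword-injective : Prime p → 1 ≤ m → (j : Fin q) → lookup B j ≡ outside ⊎ 2 ≤ m →
      ∀ u → codeword (D? m B) u ≡ 0ᵛ → u ≡ 0ᵛ
    codeword-injective pr 1≤m j h u eq = ≡0ᵛ u coordinate
      where
      open ≡-Reasoning
      J : Fin (m ℕ.+ q)
      J = m ↑ʳ j

      ↑ˡ≢J : ∀ i → i ↑ˡ q ≢ J
      ↑ˡ≢J i eq = ℕ.<⇒≢ (ℕ.<-≤-trans (Fin.toℕ<n i) (ℕ.m≤m+n m (toℕ j)))
        (trans (sym (Fin.toℕ-↑ˡ i q)) (trans (cong toℕ eq) (Fin.toℕ-↑ʳ m j)))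

      -- A lower index different from a given index.
      other : ∀ {m} → 2 ≤ m → (i : Fin (m ℕ.+ q)) → ∃ λ (i′ : Fin m) → i′ ↑ˡ q ≢ i
      other (ℕ.s≤s (ℕ.s≤s _)) Fin.zero    = Fin.suc Fin.zero , λ ()
      other (ℕ.s≤s (ℕ.s≤s _)) (Fin.suc _) = Fin.zero , λ ()

      uJ≡0 : lookup u J ≡ 0#
      uJ≡0 = trans (sym (∙-basisVector u J)) (codeword≡0⇒ (D? m B) u eq
        (D⁺ j (λ e → 1#≢0# pr (trans (sym (lookup-basisVector-≡ J)) e))
          (inj₂ (Fin.fromℕ< 1≤m , lookup-basisVector-≢ (↑ˡ≢J (Fin.fromℕ< 1≤m))))))

      coordinate : ∀ i → lookup u i ≡ 0#
      coordinate i with i Fin.≟ J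
      ... | yes refl = uJ≡0
      ... | no  i≢J  = begin
        lookup u i                       ≡⟨ +-identityʳ _ ⟨
        lookup u i +ᶠ 0#                 ≡⟨ cong₂ _+ᶠ_ (∙-basisVector u i) (trans (∙-basisVector u J) uJ≡0) ⟨
        u ∙ basisVector i +ᶠ u ∙ basisVector J  ≡⟨ ∙-+ʳ u (basisVector i) (basisVector J) ⟨
        u ∙ x                            ≡⟨ codeword≡0⇒ (D? m B) u eq (D⁺ j xJ≢0 ([ inj₁ , inj₂ ∘ zero-below ]′ h)) ⟩
        0#                               ∎
        where
        x = basisVector i +ᵛ basisVector J
        lookup-x : ∀ k → lookup x k ≡ lookup (basisVector i) k +ᶠ lookup (basisVector J) k
        lookup-x k = Vec.lookup-zipWith _+ᶠ_ k (basisVector i) (basisVector J)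
        xJ≢0 : lookup x J ≢ 0#
        xJ≢0 e = 1#≢0# pr (begin
          1#            ≡⟨ +ᶠ-identityˡ 1# ⟨
          0# +ᶠ 1#      ≡⟨ cong₂ _+ᶠ_ (lookup-basisVector-≢ (i≢J ∘ sym)) (lookup-basisVector-≡ J) ⟨
          lookup (basisVector i) J +ᶠ lookup (basisVector J) J ≡⟨ lookup-x J ⟨
          lookup x J    ≡⟨ e ⟩
          0#            ∎)
        zero-below : 2 ≤ m → ∃ λ i′ → lookup x (i′ ↑ˡ q) ≡ 0#
        zero-below 2≤m with other 2≤m i
        ... | i′ , i′≢i = i′ , trans (lookup-x (i′ ↑ˡ q))
          (trans (cong₂ _+ᶠ_ (lookup-basisVector-≢ i′≢i) (lookup-basisVector-≢ (↑ˡ≢J i′))) (+-identityʳ 0#))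

    code-hasDimension : Prime p → 1 ≤ m → (j : Fin q) → lookup B j ≡ outside ⊎ 2 ≤ m →
                        HasDimension (code (D? m B)) (m ℕ.+ q)
    code-hasDimension pr 1≤m j h = image-hasDimension (codeword-isLinearMap (D? m B))
      (λ a → a , refl) (λ Cc → Cc) (codeword-injective pr 1≤m j h)

-- Counting messages and sets of weights

-- The rational form of an integral identity p W = a X.
/-form : ∀ p .{{_ : NonZero p}} (W a X : ℤ) → + p * W ≡ a * X → W ℚ./ 1 ≡ (a ℚ./ p) ℚ.* (X ℚ./ 1)
/-form (ℕ.suc p) W a X eq = ℚ.toℚᵘ-injective (begin
  ℚ.toℚᵘ (W ℚ./ 1)                                     ≈⟨ ℚ.toℚᵘ-fromℚᵘ (ℚᵘ.mkℚᵘ W 0) ⟩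
  ℚᵘ.mkℚᵘ W 0                                          ≈⟨ ℚᵘ.*≡* lemma ⟩
  ℚᵘ.mkℚᵘ a p ℚᵘ.* ℚᵘ.mkℚᵘ X 0                         ≈⟨ ℚᵘ.*-cong (ℚ.toℚᵘ-fromℚᵘ (ℚᵘ.mkℚᵘ a p)) (ℚ.toℚᵘ-fromℚᵘ (ℚᵘ.mkℚᵘ X 0)) ⟨
  ℚ.toℚᵘ (a ℚ./ ℕ.suc p) ℚᵘ.* ℚ.toℚᵘ (X ℚ./ 1)         ≈⟨ ℚ.toℚᵘ-homo-* (a ℚ./ ℕ.suc p) (X ℚ./ 1) ⟨
  ℚ.toℚᵘ ((a ℚ./ ℕ.suc p) ℚ.* (X ℚ./ 1))               ∎)
  where
  open ℚᵘ.≃-Reasoning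
  lemma : W * + (ℕ.suc p ℕ.* 1) ≡ a * X * 1ℤ
  lemma = trans (cong (λ k → W * + k) (ℕ.*-identityʳ (ℕ.suc p)))
    (trans (ℤ.*-comm W (+ ℕ.suc p)) (trans eq (sym (ℤ.*-identityʳ (a * X)))))

iverson-01 : {A : Set} (a? : Dec A) → iverson a? ≡ 0 ⊎ iverson a? ≡ 1
iverson-01 (yes _) = inj₂ refl
iverson-01 (no _)  = inj₁ refl

iverson≟1 : {A : Set} (a? : Dec A) → ⟦ iverson a? ℕ.≟ 1 ⟧ ≡ ⟦ a? ⟧
iverson≟1 (yes _) = refl
iverson≟1 (no _)  = refl

iverson≟0 : {A : Set} (a? : Dec A) → ⟦ iverson a? ℕ.≟ 0 ⟧ ≡ 1ℤ - ⟦ a? ⟧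
iverson≟0 (yes _) = refl
iverson≟0 (no _)  = refl

pos-^ : ∀ a k → + (a ℕ.^ k) ≡ (+ a) ^ k
pos-^ a ℕ.zero    = refl
pos-^ a (ℕ.suc k) = trans (ℤ.pos-* a (a ℕ.^ k)) (cong (+ a *_) (pos-^ a k))

pos-pred : ∀ p .{{_ : NonZero p}} → + (p ∸ 1) ≡ + p - 1ℤ
pos-pred (ℕ.suc p) = refl

vPart-++ : ∀ {A : Set} {m q} (le : m ≤ m ℕ.+ q) (x : Vec A m) (y : Vec A q) → vPart le (x ++ y) ≡ x
vPart-++ le []      y = refl
vPart-++ {m = ℕ.suc m} le (a ∷ x) y = cong (a ∷_) (vPart-++ (ℕ.s≤s⁻¹ le) x y)

module Weights (p : ℕ) .{{_ : NonZero p}} where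
  open Field p
  open Spectrum p
  open Boxes p
  open Linear p

  -- The number of vectors of length m with weight k, by Pascal's rule.
  ∑-wt : ∀ m k → ∑ (allVecs p m) (λ x → ⟦ wt x ℕ.≟ k ⟧) ≡ + (m C k) * (P - 1ℤ) ^ k
  ∑-wt ℕ.zero    ℕ.zero    = refl
  ∑-wt ℕ.zero    (ℕ.suc k) = refl
  ∑-wt (ℕ.suc m) k         = begin
    ∑ (allVecs p (ℕ.suc m)) (λ x → ⟦ wt x ℕ.≟ k ⟧)
      ≡⟨ ∑-allVecs-suc p m ⟩
    ∑ (allFin p) (λ a → ∑ (allVecs p m) (λ x → ⟦ wt (a ∷ x) ℕ.≟ k ⟧))
      ≡⟨ ∑-cong (allFin p) (λ a → fibre k a) ⟩
    ∑ (allFin p) (λ a → ⟦ a Fin.≟ 0# ⟧ * N k + (1ℤ - ⟦ a Fin.≟ 0# ⟧) * N′ k)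
      ≡⟨ ∑-+ (allFin p) ⟩
    ∑ (allFin p) (λ a → ⟦ a Fin.≟ 0# ⟧ * N k) + ∑ (allFin p) (λ a → (1ℤ - ⟦ a Fin.≟ 0# ⟧) * N′ k)
      ≡⟨ cong₂ _+_ (∑-*ʳ (N k) (allFin p)) (∑-*ʳ (N′ k) (allFin p)) ⟩
    ∑ (allFin p) (indicator null) * N k + ∑ (allFin p) (indicator unit) * N′ k
      ≡⟨ cong₂ (λ a b → a * N k + b * N′ k) (∑-indicator null) (∑-indicator unit) ⟩
    1ℤ * N k + (P - 1ℤ) * N′ k
      ≡⟨ pascal k ⟩
    + (ℕ.suc m C k) * (P - 1ℤ) ^ k ∎
    where
    open ≡-Reasoning
    -- The numbers of vectors of length m with weight k and k - 1.
    N N′ : ℕ → ℤ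
    N k = ∑ (allVecs p m) (λ x → ⟦ wt x ℕ.≟ k ⟧)
    N′ ℕ.zero    = 0ℤ
    N′ (ℕ.suc k) = N k

    ∑-0 : ∀ {A : Set} (xs : List A) → ∑ xs (λ _ → 0ℤ) ≡ 0ℤ
    ∑-0 xs = trans (∑-const xs 0ℤ) (ℤ.*-zeroʳ (+ length xs))

    one : ∀ a b → a ≡ 1ℤ * a + (1ℤ - 1ℤ) * b
    one = solve-∀
    other : ∀ a b → b ≡ 0ℤ * a + (1ℤ - 0ℤ) * b
    other = solve-∀

    fibre : ∀ k a → ∑ (allVecs p m) (λ x → ⟦ wt (a ∷ x) ℕ.≟ k ⟧) ≡ ⟦ a Fin.≟ 0# ⟧ * N k + (1ℤ - ⟦ a Fin.≟ 0# ⟧) * N′ k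
    fibre k         a with a Fin.≟ 0#
    fibre k         a | yes _ = one (N k) (N′ k)
    fibre ℕ.zero    a | no _  = trans (∑-0 (allVecs p m)) (other (N 0) 0ℤ)
    fibre (ℕ.suc k) a | no _  = other (N (ℕ.suc k)) (N k)

    pascal : ∀ k → 1ℤ * N k + (P - 1ℤ) * N′ k ≡ + (ℕ.suc m C k) * (P - 1ℤ) ^ k
    pascal ℕ.zero    = trans (cong (λ a → 1ℤ * a + (P - 1ℤ) * 0ℤ) (∑-wt m 0)) (lemma P)
      where
      lemma : ∀ P → 1ℤ * (1ℤ * 1ℤ) + (P - 1ℤ) * 0ℤ ≡ 1ℤ * 1ℤ
      lemma = solve-∀
    pascal (ℕ.suc k) = begin
      1ℤ * N (ℕ.suc k) + (P - 1ℤ) * N k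
        ≡⟨ cong₂ (λ a b → 1ℤ * a + (P - 1ℤ) * b) (∑-wt m (ℕ.suc k)) (∑-wt m k) ⟩
      1ℤ * (+ (m C ℕ.suc k) * ((P - 1ℤ) * (P - 1ℤ) ^ k)) + (P - 1ℤ) * (+ (m C k) * (P - 1ℤ) ^ k)
        ≡⟨ lemma (P - 1ℤ) (+ (m C ℕ.suc k)) (+ (m C k)) ((P - 1ℤ) ^ k) ⟩
      (+ (m C k) + + (m C ℕ.suc k)) * ((P - 1ℤ) * (P - 1ℤ) ^ k)
        ≡⟨ cong (_* ((P - 1ℤ) * (P - 1ℤ) ^ k)) (cong +_ (nCk+nC[k+1]≡[n+1]C[k+1] m k)) ⟩
      + (ℕ.suc m C ℕ.suc k) * ((P - 1ℤ) * (P - 1ℤ) ^ k) ∎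
      where
      lemma : ∀ u a b t → 1ℤ * (a * (u * t)) + u * (b * t) ≡ (b + a) * (u * t)
      lemma = solve-∀

  ∑-vanishesOn : ∀ {q} (B : Subset q) → ∑ (allVecs p q) (λ y → ⟦ vanishesOn? B y ⟧) ≡ P ^ (q ∸ ∣ B ∣)
  ∑-vanishesOn {q} B = begin
    ∑ (allVecs p q) (λ y → ⟦ vanishesOn? B y ⟧)         ≡⟨ ∑-cong (allVecs p q) (λ y →
      trans (⟦⟧-cong (vanishesOn? B y) (inBox? κs y) (to y) (from y)) (sym (boxIndicator≡⟦⟧ κs y))) ⟩
    ∑ (allVecs p q) (boxIndicator κs)                   ≡⟨ ∑-boxIndicator κs ⟩
    boxCardinality κs                                   ≡⟨ boxCardinality-subset (∁ B) ⟩
    P ^ ∣ ∁ B ∣                                         ≡⟨ cong (P ^_) (∣∁p∣≡n∸∣p∣ B) ⟩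
    P ^ (q ∸ ∣ B ∣)                                     ∎
    where
    open ≡-Reasoning
    κs = Vec.map kindOf (∁ B)
    lookup-κs : ∀ i → lookup κs i ≡ kindOf (not (lookup B i))
    lookup-κs i = trans (Vec.lookup-map i kindOf (∁ B)) (cong kindOf (Vec.lookup-map i not B))
    to : ∀ y → VanishesOn B y → InBox κs y
    to y h i = subst (λ κ → Allowed κ (lookup y i)) (sym (lookup-κs i)) (go (lookup B i) refl)
      where
      go : ∀ s → lookup B i ≡ s → Allowed (kindOf (not s)) (lookup y i)
      go inside  eq = h i (Vec.lookup⇒[]= i B eq)
      go outside eq = tt
    from : ∀ y → InBox κs y → VanishesOn B y
    from y h i i∈B = subst (λ κ → Allowed κ (lookup y i)) (trans (lookup-κs i) (cong (kindOf ∘ not) (Vec.[]=⇒lookup i∈B))) (h i)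

  ∑-1 : ∀ n → ∑ (allVecs p n) (λ _ → 1ℤ) ≡ P ^ n
  ∑-1 n = trans (∑-cong (allVecs p n) λ x → sym (boxIndicator-full x))
    (trans (∑-boxIndicator (replicate n full)) (boxCardinality-replicate n full))

  -- Counting the nonzero solutions of a decidable condition.
  ∑-nonzero : ∀ n {Q : Pred (Vec (𝔽 p) n) 0ℓ} (Q? : Decidable Q) →
    + size (λ u → ¬? (u ≟ᵛ 0ᵛ) ×-dec Q? u) ≡ ∑ (allVecs p n) (λ u → ⟦ Q? u ⟧) - ⟦ Q? 0ᵛ ⟧
  ∑-nonzero n Q? = begin
    + size (λ u → ¬? (u ≟ᵛ 0ᵛ) ×-dec Q? u)                     ≡⟨ size≡∑ (λ u → ¬? (u ≟ᵛ 0ᵛ) ×-dec Q? u) ⟩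
    ∑ V (λ u → ⟦ ¬? (u ≟ᵛ 0ᵛ) ×-dec Q? u ⟧)                    ≡⟨ ∑-cong V (λ u → split₀ u (u ≟ᵛ 0ᵛ)) ⟩
    ∑ V (λ u → ⟦ Q? u ⟧ - ⟦ u ≟ᵛ 0ᵛ ⟧ * ⟦ Q? 0ᵛ ⟧)             ≡⟨ ∑-- V ⟩
    ∑ V (λ u → ⟦ Q? u ⟧) - ∑ V (λ u → ⟦ u ≟ᵛ 0ᵛ ⟧ * ⟦ Q? 0ᵛ ⟧) ≡⟨ cong (_-_ (∑ V (λ u → ⟦ Q? u ⟧))) (∑-*ʳ ⟦ Q? 0ᵛ ⟧ V) ⟩
    ∑ V (λ u → ⟦ Q? u ⟧) - ∑ V (λ u → ⟦ u ≟ᵛ 0ᵛ ⟧) * ⟦ Q? 0ᵛ ⟧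
      ≡⟨ cong (λ s → ∑ V (λ u → ⟦ Q? u ⟧) - s * ⟦ Q? 0ᵛ ⟧) (∑-single _≟ᵛ_ (allVecs-unique p n) (∈-allVecs 0ᵛ)) ⟩
    ∑ V (λ u → ⟦ Q? u ⟧) - 1ℤ * ⟦ Q? 0ᵛ ⟧                      ≡⟨ cong (_-_ (∑ V (λ u → ⟦ Q? u ⟧))) (ℤ.*-identityˡ ⟦ Q? 0ᵛ ⟧) ⟩
    ∑ V (λ u → ⟦ Q? u ⟧) - ⟦ Q? 0ᵛ ⟧                           ∎
    where
    open ≡-Reasoning
    V = allVecs p n
    cancel : ∀ a → 0ℤ ≡ a - 1ℤ * a
    cancel = solve-∀
    keep : ∀ a b → a ≡ a - 0ℤ * b
    keep = solve-∀
    split₀ : ∀ u (d : Dec (u ≡ 0ᵛ)) → ⟦ ¬? d ×-dec Q? u ⟧ ≡ ⟦ Q? u ⟧ - ⟦ d ⟧ * ⟦ Q? 0ᵛ ⟧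
    split₀ u (yes refl) = cancel ⟦ Q? 0ᵛ ⟧
    split₀ u (no _)     = keep ⟦ Q? u ⟧ ⟦ Q? 0ᵛ ⟧

  replicate-++ : ∀ {A : Set} m q {a : A} → replicate m a ++ replicate q a ≡ replicate (m ℕ.+ q) a
  replicate-++ ℕ.zero    q = refl
  replicate-++ (ℕ.suc m) q = cong (_ ∷_) (replicate-++ m q)

  vanishes-0ᵛ : ∀ {q} (B : Subset q) → ⟦ vanishesOn? B (0ᵛ {p}) ⟧ ≡ 1ℤ
  vanishes-0ᵛ B = ⟦⟧-yes (vanishesOn? B 0ᵛ) (λ i _ → Vec.lookup-replicate i 0#)

  module _ (m : ℕ) {q : ℕ} (B : Subset q) (le : m ≤ m ℕ.+ q) where

    -- The number of nonzero (v , w) with wt v = k and δ = d, where δ = d is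
    -- given by a function g of w: the choices of v and w are independent. The
    -- last term removes the zero vector.
    count-by : ∀ k d (g : Vec (𝔽 p) q → ℤ) → (∀ x y → ⟦ δ (shift m B) (x ++ y) ℕ.≟ d ⟧ ≡ g y) →
      + size (λ u → ¬? (u ≟ᵛ 0ᵛ) ×-dec (wt (vPart le u) ℕ.≟ k) ×-dec (δ (shift m B) u ℕ.≟ d))
      ≡ + (m C k) * (P - 1ℤ) ^ k * ∑ (allVecs p q) g - ⟦ k ℕ.≟ 0 ⟧ * g 0ᵛ
    count-by k d g δ≡g = begin
      + size (λ u → ¬? (u ≟ᵛ 0ᵛ) ×-dec Q? u)
        ≡⟨ ∑-nonzero (m ℕ.+ q) Q? ⟩
      ∑ (allVecs p (m ℕ.+ q)) (λ u → ⟦ Q? u ⟧) - ⟦ Q? 0ᵛ ⟧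
        ≡⟨ cong₂ _-_ (∑-allVecs-++ p m q) (cong (λ u → ⟦ Q? u ⟧) (sym (replicate-++ m q))) ⟩
      ∑ (allVecs p m) (λ x → ∑ (allVecs p q) (λ y → ⟦ Q? (x ++ y) ⟧)) - ⟦ Q? (0ᵛ {n = m} ++ 0ᵛ {n = q}) ⟧
        ≡⟨ cong₂ _-_ (∑-cong (allVecs p m) λ x → trans (∑-cong (allVecs p q) λ y → Q-++ x y) (∑-*ˡ ⟦ wt x ℕ.≟ k ⟧ (allVecs p q)))
             (trans (Q-++ 0ᵛ 0ᵛ) (cong (_* g 0ᵛ) (trans (cong (λ j → ⟦ j ℕ.≟ k ⟧) (wt-0ᵛ m)) (⟦⟧-cong (0 ℕ.≟ k) (k ℕ.≟ 0) sym sym)))) ⟩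
      ∑ (allVecs p m) (λ x → ⟦ wt x ℕ.≟ k ⟧ * ∑ (allVecs p q) g) - ⟦ k ℕ.≟ 0 ⟧ * g 0ᵛ
        ≡⟨ cong (_- ⟦ k ℕ.≟ 0 ⟧ * g 0ᵛ) (trans (∑-*ʳ (∑ (allVecs p q) g) (allVecs p m)) (cong (_* ∑ (allVecs p q) g) (∑-wt m k))) ⟩
      + (m C k) * (P - 1ℤ) ^ k * ∑ (allVecs p q) g - ⟦ k ℕ.≟ 0 ⟧ * g 0ᵛ ∎
      where
      open ≡-Reasoning
      Q? : Decidable (λ (u : Vec (𝔽 p) (m ℕ.+ q)) → wt (vPart le u) ≡ k × δ (shift m B) u ≡ d)
      Q? u = (wt (vPart le u) ℕ.≟ k) ×-dec (δ (shift m B) u ℕ.≟ d)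
      Q-++ : ∀ x y → ⟦ Q? (x ++ y) ⟧ ≡ ⟦ wt x ℕ.≟ k ⟧ * g y
      Q-++ x y = trans (⟦⟧-× (wt (vPart le (x ++ y)) ℕ.≟ k) (δ (shift m B) (x ++ y) ℕ.≟ d))
        (cong₂ _*_ (cong (λ v → ⟦ wt v ℕ.≟ k ⟧) (vPart-++ le x y)) (δ≡g x y))

    count₁ : ∀ k →
      + size (λ (u : Vec (𝔽 p) (m ℕ.+ q)) → ¬? (u ≟ᵛ 0ᵛ) ×-dec (wt (vPart le u) ℕ.≟ k) ×-dec (δ (shift m B) u ℕ.≟ 1))
      ≡ + (m C k) * (P - 1ℤ) ^ k * P ^ (q ∸ ∣ B ∣) - ⟦ k ℕ.≟ 0 ⟧
    count₁ k = trans (count-by k 1 (λ y → ⟦ vanishesOn? B y ⟧)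
        (λ x y → trans (iverson≟1 (vanishesOn? (shift m B) (x ++ y))) (sym (vanishes-shift m B x y))))
      (cong₂ (λ s z → + (m C k) * (P - 1ℤ) ^ k * s - z) (∑-vanishesOn B)
        (trans (cong (⟦ k ℕ.≟ 0 ⟧ *_) (vanishes-0ᵛ B)) (ℤ.*-identityʳ ⟦ k ℕ.≟ 0 ⟧)))

    count₀ : ∀ k →
      + size (λ (u : Vec (𝔽 p) (m ℕ.+ q)) → ¬? (u ≟ᵛ 0ᵛ) ×-dec (wt (vPart le u) ℕ.≟ k) ×-dec (δ (shift m B) u ℕ.≟ 0))
      ≡ + (m C k) * (P - 1ℤ) ^ k * (P ^ q - P ^ (q ∸ ∣ B ∣))
    count₀ k = begin
      + size (λ (u : Vec (𝔽 p) (m ℕ.+ q)) → ¬? (u ≟ᵛ 0ᵛ) ×-dec (wt (vPart le u) ℕ.≟ k) ×-dec (δ (shift m B) u ℕ.≟ 0))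
        ≡⟨ count-by k 0 (λ y → 1ℤ - ⟦ vanishesOn? B y ⟧)
             (λ x y → trans (iverson≟0 (vanishesOn? (shift m B) (x ++ y))) (cong (_-_ 1ℤ) (sym (vanishes-shift m B x y)))) ⟩
      + (m C k) * (P - 1ℤ) ^ k * ∑ (allVecs p q) (λ y → 1ℤ - ⟦ vanishesOn? B y ⟧) - ⟦ k ℕ.≟ 0 ⟧ * (1ℤ - ⟦ vanishesOn? B 0ᵛ ⟧)
        ≡⟨ cong₂ (λ s z → + (m C k) * (P - 1ℤ) ^ k * s - ⟦ k ℕ.≟ 0 ⟧ * (1ℤ - z))
             (trans (∑-- (allVecs p q)) (cong₂ _-_ (∑-1 q) (∑-vanishesOn B))) (vanishes-0ᵛ B) ⟩
      + (m C k) * (P - 1ℤ) ^ k * (P ^ q - P ^ (q ∸ ∣ B ∣)) - ⟦ k ℕ.≟ 0 ⟧ * (1ℤ - 1ℤ)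
        ≡⟨ lemma (+ (m C k) * (P - 1ℤ) ^ k * (P ^ q - P ^ (q ∸ ∣ B ∣))) ⟦ k ℕ.≟ 0 ⟧ ⟩
      + (m C k) * (P - 1ℤ) ^ k * (P ^ q - P ^ (q ∸ ∣ B ∣)) ∎
      where
      open ≡-Reasoning
      lemma : ∀ a z → a - z * (1ℤ - 1ℤ) ≡ a
      lemma = solve-∀

  module _ {n : ℕ} {D : Pred (Vec (𝔽 p) n) 0ℓ} (D? : Decidable D) where

    hasNonzeroWeights : ∀ {ws} → Unique ws →
      All (λ w → w ≢ 0 × ∃ λ u → wt (codeword D? u) ≡ w) ws →
      (∀ u → wt (codeword D? u) ≢ 0 → wt (codeword D? u) ∈ˡ ws) →
      HasNonzeroWeights (code D?) ws
    hasNonzeroWeights unique attained complete = record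
      { distinct = unique
      ; exact    = λ w → mk⇔
          (λ w∈ → let (w≢0 , u , eq) = All.lookup attained w∈ in w≢0 , codeword D? u , (u , refl) , eq)
          λ { (w≢0 , _ , (u , refl) , refl) → complete u w≢0 } }

    -- If the nonzero weights lie in a list cs, then their number is at most
    -- the length of cs, as it is decidable whether a weight is attained.
    fewWeights : ∀ cs → (∀ u → wt (codeword D? u) ≢ 0 → wt (codeword D? u) ∈ˡ cs) →
      ∃ λ s → s ≤ length cs × Is s -Weight (code D?)
    fewWeights cs complete = length ws , ℕ.≤-trans (List.length-filter attained? (deduplicate ℕ._≟_ cs)) (List.length-deduplicate ℕ._≟_ cs) ,
      ws , refl , hasNonzeroWeights
        (Unique.filter⁺ attained? (deduplicate-! cs))
        (All.tabulate λ w∈ → proj₂ (∈-filter⁻ attained? {xs = deduplicate ℕ._≟_ cs} w∈))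
        (λ u w≢0 → ∈-filter⁺ attained? (∈-deduplicate⁺ ℕ._≟_ (complete u w≢0)) (w≢0 , u , refl))
      where
      attained? : Decidable (λ w → w ≢ 0 × ∃ λ u → wt (codeword D? u) ≡ w)
      attained? w = ¬? (w ℕ.≟ 0) ×-dec
        map′ (λ any → let (u , _ , eq) = find any in u , eq)
             (λ (u , eq) → lose (∈-allVecs u) eq)
             (Any.any? (λ u → wt (codeword D? u) ℕ.≟ w) (allVecs p n))
      ws = filter attained? (deduplicate ℕ._≟_ cs)

    wt-codeword-0 : wt (codeword D? 0ᵛ) ≡ 0
    wt-codeword-0 = trans (cong wt (IsLinearMap.0-homo (codeword-isLinearMap D?))) (wt-0ᵛ (size D?))

    wt≢0⇒≢0ᵛ : ∀ u → wt (codeword D? u) ≢ 0 → u ≢ 0ᵛ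
    wt≢0⇒≢0ᵛ u w≢0 refl = w≢0 wt-codeword-0

    dist-codeword : ∀ u v → dist (codeword D? u) (codeword D? v) ≡ wt (codeword D? (u +ᵛ -1ᶠ *ᵛ v))
    dist-codeword u v = trans (dist≡wt (codeword D? u) (codeword D? v)) (cong wt (sym
      (trans (+-homo u (-1ᶠ *ᵛ v)) (cong (codeword D? u +ᵛ_) (*-homo -1ᶠ v)))))
      where open IsLinearMap (codeword-isLinearMap D?)

    -- If all nonzero weights equal d, then so does every distance between
    -- distinct codewords.
    oneWeight-minimumDistance : ∀ {d} → d ≢ 0 → (∃ λ u → wt (codeword D? u) ≡ d) →
      (∀ u → wt (codeword D? u) ≢ 0 → wt (codeword D? u) ≡ d) → HasMinimumDistance (code D?) d
    oneWeight-minimumDistance {d} d≢0 (u₀ , eq₀) oneWeight = record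
      { attained = codeword D? u₀ , codeword D? 0ᵛ , (u₀ , refl) , (0ᵛ , refl)
                 , (λ eq → d≢0 (trans (sym eq₀) (trans (cong wt eq) wt-codeword-0)))
                 , trans (dist-codeword u₀ 0ᵛ) (trans (cong (wt ∘ codeword D?) (trans (cong (u₀ +ᵛ_) (*ᵛ-zeroʳ -1ᶠ)) (+ᵛ-identityʳ u₀))) eq₀)
      ; minimal  = λ { (u , refl) (v , refl) x≢y → ℕ.≤-reflexive (sym (trans (dist-codeword u v)
          (oneWeight (u +ᵛ -1ᶠ *ᵛ v) (λ eq → x≢y (dist≡0⇒≡ _ _ (trans (dist-codeword u v) eq)))))) } }

-- The weights for general m

module Main (p : ℕ) .{{_ : NonZero p}} (prime : Prime p) where
  open Field p
  open Spectrum p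
  open Boxes p
  open Linear p
  open Weights p

  module _ (m : ℕ) {q : ℕ} (B : Subset q) where

    -- Every nonzero weight is one of the numbers that the weight formula
    -- yields for the pairs (k , δ) with k at most m and δ at most 1.
    fewWeights-D : ∃ λ s → s ≤ 2 ℕ.* (m ℕ.+ 1) × Is s -Weight (code (D? m B))
    fewWeights-D = subst (λ l → ∃ λ s → s ≤ l × Is s -Weight (code (D? m B))) length-candidates
      (fewWeights (D? m B) candidates complete)
      where
      -- The weight formula, solved for the weight by a division that is exact
      -- for the pairs that occur.
      f : ℕ → ℕ → ℕ
      f d k = ℤ.∣ (P - 1ℤ) * (+ size (D? m B) + P ^ m * ⟦ k ℕ.≟ 0 ⟧ + T m k * (P ^ ∣ B ∣ * + d - 1ℤ)) ∣ ℕ./ p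

      candidates : List ℕ
      candidates = List.map (f 0) (upTo (ℕ.suc m)) List.++ List.map (f 1) (upTo (ℕ.suc m))

      length-candidates : length candidates ≡ 2 ℕ.* (m ℕ.+ 1)
      length-candidates = begin
        length candidates
          ≡⟨ List.length-++ (List.map (f 0) (upTo (ℕ.suc m))) ⟩
        length (List.map (f 0) (upTo (ℕ.suc m))) ℕ.+ length (List.map (f 1) (upTo (ℕ.suc m)))
          ≡⟨ cong₂ ℕ._+_ (length-half 0) (length-half 1) ⟩
        m ℕ.+ 1 ℕ.+ (m ℕ.+ 1)
          ≡⟨ cong (m ℕ.+ 1 ℕ.+_) (ℕ.+-identityʳ (m ℕ.+ 1)) ⟨
        2 ℕ.* (m ℕ.+ 1) ∎
        where
        open ≡-Reasoning
        length-half : ∀ d → length (List.map (f d) (upTo (ℕ.suc m))) ≡ m ℕ.+ 1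
        length-half d = trans (List.length-map (f d) (upTo (ℕ.suc m)))
          (trans (List.length-upTo (ℕ.suc m)) (sym (ℕ.+-comm m 1)))

      complete-++ : ∀ x y → wt (codeword (D? m B) (x ++ y)) ≢ 0 → wt (codeword (D? m B) (x ++ y)) ∈ˡ candidates
      complete-++ x y w≢0 = subst (_∈ˡ candidates) (sym w≡f) (f∈ (iverson-01 (vanishesOn? (shift m B) (x ++ y))))
        where
        u≢0 : x ++ y ≢ 0ᵛ
        u≢0 = wt≢0⇒≢0ᵛ (D? m B) (x ++ y) w≢0
        w≡f : wt (codeword (D? m B) (x ++ y)) ≡ f (δ (shift m B) (x ++ y)) (wt x)
        w≡f = begin
          wt (codeword (D? m B) (x ++ y))
            ≡⟨ m*n/n≡m _ p ⟨
          wt (codeword (D? m B) (x ++ y)) ℕ.* p ℕ./ p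
            ≡⟨ cong (ℕ._/ p) (ℕ.*-comm _ p) ⟩
          p ℕ.* wt (codeword (D? m B) (x ++ y)) ℕ./ p
            ≡⟨ cong (ℕ._/ p) (ℤ.abs-* P (+ wt (codeword (D? m B) (x ++ y)))) ⟨
          ℤ.∣ P * + wt (codeword (D? m B) (x ++ y)) ∣ ℕ./ p
            ≡⟨ cong (λ z → ℤ.∣ z ∣ ℕ./ p) (weight-formula m B prime x y u≢0) ⟩
          f (δ (shift m B) (x ++ y)) (wt x) ∎
          where open ≡-Reasoning
        k∈ : wt x ∈ˡ upTo (ℕ.suc m)
        k∈ = ∈-upTo⁺ (s≤s (wt≤ x))
        f∈ : ∀ {d} → d ≡ 0 ⊎ d ≡ 1 → f d (wt x) ∈ˡ candidates
        f∈ (inj₁ refl) = ∈-++⁺ˡ (∈-map⁺ (f 0) k∈)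
        f∈ (inj₂ refl) = ∈-++⁺ʳ (List.map (f 0) (upTo (ℕ.suc m))) (∈-map⁺ (f 1) k∈)

      complete : ∀ u → wt (codeword (D? m B) u) ≢ 0 → wt (codeword (D? m B) u) ∈ˡ candidates
      complete u w≢0 = let (x , y , eq) = Vec.splitAt m u in
        subst (λ u → wt (codeword (D? m B) u) ∈ˡ candidates) (sym eq)
          (complete-++ x y (subst (λ u → wt (codeword (D? m B) u) ≢ 0) eq w≢0))

    module _ (le : m ≤ m ℕ.+ q) where

      weight-formula-ℚ : ∀ (u : Vec (𝔽 p) (m ℕ.+ q)) → u ≢ 0ᵛ → let k = wt (vPart le u) in
        + wt (codeword (D? m B) u) ℚ./ 1
        ≡ ((P - 1ℤ) ℚ./ p)
          ℚ.* ((+ size (D? m B) + P ^ m * ⟦ k ℕ.≟ 0 ⟧ + T m k * (P ^ ∣ B ∣ * + δ (shift m B) u - 1ℤ)) ℚ./ 1)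
      weight-formula-ℚ u u≢0 = let (x , y , eq) = Vec.splitAt m u in
        subst Formula (sym eq) (formula-++ x y (subst (_≢ 0ᵛ) eq u≢0))
        where
        X : ℕ → ℕ → ℤ
        X k d = + size (D? m B) + P ^ m * ⟦ k ℕ.≟ 0 ⟧ + T m k * (P ^ ∣ B ∣ * + d - 1ℤ)
        Formula : Vec (𝔽 p) (m ℕ.+ q) → Set
        Formula u = + wt (codeword (D? m B) u) ℚ./ 1
                    ≡ ((P - 1ℤ) ℚ./ p) ℚ.* (X (wt (vPart le u)) (δ (shift m B) u) ℚ./ 1)
        formula-++ : ∀ x y → x ++ y ≢ 0ᵛ → Formula (x ++ y)
        formula-++ x y u≢0 = trans
          (/-form p (+ wt (codeword (D? m B) (x ++ y))) (P - 1ℤ) (X (wt x) (δ (shift m B) (x ++ y))) (weight-formula m B prime x y u≢0))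
          (cong (λ v → ((P - 1ℤ) ℚ./ p) ℚ.* (X (wt v) (δ (shift m B) (x ++ y)) ℚ./ 1)) (sym (vPart-++ le x y)))

      counts : ∀ k →
        let countOf : ℕ → ℕ
            countOf d = size (λ (u : Vec (𝔽 p) (m ℕ.+ q)) →
              ¬? (u ≟ᵛ 0ᵛ) ×-dec (wt (vPart le u) ℕ.≟ k) ×-dec (δ (shift m B) u ℕ.≟ d))
            e = m ℕ.+ q ∸ m
        in (+ countOf 0 ≡ + (m C k) * (P - 1ℤ) ^ k * (P ^ e - P ^ (e ∸ ∣ B ∣)))
           × (+ countOf 1 ≡ + (m C k) * (P - 1ℤ) ^ k * P ^ (e ∸ ∣ B ∣) - ⟦ k ℕ.≟ 0 ⟧)
      counts k =
          trans (count₀ m B le k) (cong (λ e → + (m C k) * (P - 1ℤ) ^ k * (P ^ e - P ^ (e ∸ ∣ B ∣))) (sym (ℕ.m+n∸m≡n m q)))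
        , trans (count₁ m B le k) (cong (λ e → + (m C k) * (P - 1ℤ) ^ k * P ^ (e ∸ ∣ B ∣) - ⟦ k ℕ.≟ 0 ⟧) (sym (ℕ.m+n∸m≡n m q)))

  -- The case m = 1

  wt-singleton-0 : wt (0# {p} ∷ []) ≡ 0
  wt-singleton-0 = wt-0ᵛ 1

  wt-singleton : ∀ {a : 𝔽 p} → a ≢ 0# → wt (a ∷ []) ≡ 1
  wt-singleton {a} a≢0 with a Fin.≟ 0#
  ... | yes eq = contradiction eq a≢0
  ... | no _   = refl

  wt-01 : ∀ a → wt (a ∷ []) ≡ 0 ⊎ wt (a ∷ []) ≡ 1
  wt-01 a with a Fin.≟ 0#
  ... | yes _ = inj₁ refl
  ... | no _  = inj₂ refl

  basis≢0 : ∀ {n} (i : Fin n) → basisVector i ≢ 0ᵛ {p}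
  basis≢0 i eq = 1#≢0# prime (trans (sym (lookup-basisVector-≡ i)) (trans (cong (λ v → lookup v i) eq) (Vec.lookup-replicate i 0#)))

  module _ {q : ℕ} (B : Subset q) where

    D₁? : Decidable (DefiningSet p 1 (shift 1 B))
    D₁? = D? 1 B

    W : Vec (𝔽 p) (ℕ.suc q) → ℕ
    W u = wt (codeword D₁? u)

    size-D₁ : + size D₁? ≡ P ^ ℕ.suc q - (P - 1ℤ) * P ^ ∣ B ∣ - 1ℤ
    size-D₁ = trans (size-D 1 B) (lemma P (P ^ q) (P ^ ∣ B ∣))
      where
      lemma : ∀ P Q b → P * Q - P * 1ℤ - (P - 1ℤ) * 1ℤ * (b - 1ℤ) ≡ P * Q - (P - 1ℤ) * b - 1ℤ
      lemma = solve-∀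

    -- The right-hand side of the weight formula for m = 1, in terms of the
    -- size b of B and of the class (k , d) of the message.
    weightTerm : ℕ → ℕ → ℕ → ℤ
    weightTerm b k d = (P - 1ℤ) *
      ((P ^ ℕ.suc q - (P - 1ℤ) * P ^ b - 1ℤ) + P ^ 1 * ⟦ k ℕ.≟ 0 ⟧ + T 1 k * (P ^ b * + d - 1ℤ))

    weight-formula₁ : ∀ {a y k d} → a ∷ y ≢ 0ᵛ → wt (a ∷ []) ≡ k → δ (shift 1 B) (a ∷ y) ≡ d →
      P * + W (a ∷ y) ≡ weightTerm ∣ B ∣ k d
    weight-formula₁ {a} {y} u≢0 refl refl = trans (weight-formula 1 B prime (a ∷ []) y u≢0)
      (cong (λ s → (P - 1ℤ) * (s + P ^ 1 * ⟦ wt (a ∷ []) ℕ.≟ 0 ⟧ + T 1 (wt (a ∷ [])) * (P ^ ∣ B ∣ * + δ (shift 1 B) (a ∷ y) - 1ℤ))) size-D₁)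

    private
      -- The number of units.
      r : ℕ
      r = p ∸ 1

      pos-r : + r ≡ P - 1ℤ
      pos-r = pos-pred p

      pos-rp^ : ∀ k → + (r ℕ.* p ℕ.^ k) ≡ (P - 1ℤ) * P ^ k
      pos-rp^ k = trans (ℤ.pos-* r (p ℕ.^ k)) (cong₂ _*_ pos-r (pos-^ p k))

      cancel-P : ∀ {i j} → P * i ≡ P * j → i ≡ j
      cancel-P {i} {j} = ℤ.*-cancelˡ-≡ P i j

    δ-1 : ∀ u → VanishesOn (shift 1 B) u → δ (shift 1 B) u ≡ 1
    δ-1 u h = ℤ.+-injective (⟦⟧-yes (vanishesOn? (shift 1 B) u) h)

    δ-0 : ∀ u → ¬ VanishesOn (shift 1 B) u → δ (shift 1 B) u ≡ 0
    δ-0 u h = ℤ.+-injective (⟦⟧-no (vanishesOn? (shift 1 B) u) h)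

    module _ {c : ℕ} (∣B∣≡ : ∣ B ∣ ≡ ℕ.suc c) where

      -- The values of the weight according to (k , δ), without subtraction.
      -- The value for δ = 0 does not depend on k.
      weight-0 : ∀ {a y} → a ∷ y ≢ 0ᵛ → wt (a ∷ []) ≡ 0 ⊎ wt (a ∷ []) ≡ 1 → δ (shift 1 B) (a ∷ y) ≡ 0 →
        W (a ∷ y) ℕ.+ r ℕ.^ 2 ℕ.* p ℕ.^ c ≡ r ℕ.* p ℕ.^ q
      weight-0 {a} {y} u≢0 k01 δ≡ = ℤ.+-injective (begin
        + W (a ∷ y) + + (r ℕ.^ 2 ℕ.* p ℕ.^ c)
          ≡⟨ cong₂ _+_ (cancel-P (trans (weight-formula₁ u≢0 refl δ≡)
               (trans (cong (λ b → weightTerm b (wt (a ∷ [])) 0) ∣B∣≡) (value k01))))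
               (trans (ℤ.pos-* (r ℕ.^ 2) (p ℕ.^ c)) (cong₂ _*_ (trans (pos-^ r 2) (cong (_^ 2) pos-r)) (pos-^ p c))) ⟩
        (P - 1ℤ) * P ^ q - (P - 1ℤ) * (P - 1ℤ) * P ^ c + (P - 1ℤ) ^ 2 * P ^ c
          ≡⟨ lemma (P - 1ℤ) (P ^ q) (P ^ c) ⟩
        (P - 1ℤ) * P ^ q
          ≡⟨ pos-rp^ q ⟨
        + (r ℕ.* p ℕ.^ q) ∎)
        where
        open ≡-Reasoning
        lemma : ∀ u Q β → u * Q - u * u * β + u * (u * 1ℤ) * β ≡ u * Q
        lemma = solve-∀
        value : ∀ {k} → k ≡ 0 ⊎ k ≡ 1 →
          weightTerm (ℕ.suc c) k 0 ≡ P * ((P - 1ℤ) * P ^ q - (P - 1ℤ) * (P - 1ℤ) * P ^ c)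
        value (inj₁ refl) = go P (P ^ q) (P ^ c)
          where
          go : ∀ P Q β → (P - 1ℤ) * ((P * Q - (P - 1ℤ) * (P * β) - 1ℤ) + P * 1ℤ * 1ℤ + 1ℤ * ((P - 1ℤ) * 1ℤ) * (P * β * 0ℤ - 1ℤ))
                         ≡ P * ((P - 1ℤ) * Q - (P - 1ℤ) * (P - 1ℤ) * β)
          go = solve-∀
        value (inj₂ refl) = go P (P ^ q) (P ^ c)
          where
          go : ∀ P Q β → (P - 1ℤ) * ((P * Q - (P - 1ℤ) * (P * β) - 1ℤ) + P * 1ℤ * 0ℤ + -1ℤ * 1ℤ * 1ℤ * (P * β * 0ℤ - 1ℤ))
                         ≡ P * ((P - 1ℤ) * Q - (P - 1ℤ) * (P - 1ℤ) * β)
          go = solve-∀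

      weight-11 : ∀ {a y} → a ∷ y ≢ 0ᵛ → wt (a ∷ []) ≡ 1 → δ (shift 1 B) (a ∷ y) ≡ 1 →
        W (a ∷ y) ℕ.+ r ℕ.* p ℕ.^ ℕ.suc c ≡ r ℕ.* p ℕ.^ q
      weight-11 {a} {y} u≢0 k≡ δ≡ = ℤ.+-injective (begin
        + W (a ∷ y) + + (r ℕ.* p ℕ.^ ℕ.suc c)
          ≡⟨ cong₂ _+_ (cancel-P (trans (weight-formula₁ u≢0 k≡ δ≡)
               (trans (cong (λ b → weightTerm b 1 1) ∣B∣≡) (value P (P ^ q) (P ^ c)))))
               (pos-rp^ (ℕ.suc c)) ⟩
        (P - 1ℤ) * P ^ q - (P - 1ℤ) * (P * P ^ c) + (P - 1ℤ) * (P * P ^ c)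
          ≡⟨ lemma (P - 1ℤ) (P ^ q) (P * P ^ c) ⟩
        (P - 1ℤ) * P ^ q
          ≡⟨ pos-rp^ q ⟨
        + (r ℕ.* p ℕ.^ q) ∎)
        where
        open ≡-Reasoning
        lemma : ∀ u Q β → u * Q - u * β + u * β ≡ u * Q
        lemma = solve-∀
        value : ∀ P Q β → (P - 1ℤ) * ((P * Q - (P - 1ℤ) * (P * β) - 1ℤ) + P * 1ℤ * 0ℤ + -1ℤ * 1ℤ * 1ℤ * (P * β * 1ℤ - 1ℤ))
                ≡ P * ((P - 1ℤ) * Q - (P - 1ℤ) * (P * β))
        value = solve-∀

      weight-01 : ∀ {a y} → a ∷ y ≢ 0ᵛ → wt (a ∷ []) ≡ 0 → δ (shift 1 B) (a ∷ y) ≡ 1 →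
        W (a ∷ y) ≡ r ℕ.* p ℕ.^ q
      weight-01 {a} {y} u≢0 k≡ δ≡ = ℤ.+-injective (trans
        (cancel-P (trans (weight-formula₁ u≢0 k≡ δ≡) (value P (P ^ q) (P ^ ∣ B ∣))))
        (sym (pos-rp^ q)))
        where
        value : ∀ P Q β → (P - 1ℤ) * ((P * Q - (P - 1ℤ) * β - 1ℤ) + P * 1ℤ * 1ℤ + 1ℤ * ((P - 1ℤ) * 1ℤ) * (β * 1ℤ - 1ℤ))
                ≡ P * ((P - 1ℤ) * Q)
        value = solve-∀

      private
        1<p′ : 1 < p
        1<p′ = 1<p prime

        0<r : 0 < r
        0<r = ℕ.m<n⇒0<n∸m 1<p′

        0<p^ : ∀ k → 0 < p ℕ.^ k
        0<p^ k = ℕ.m^n>0 p k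

      r-nonZero : NonZero r
      r-nonZero = ℕ.>-nonZero 0<r

      -- The three weights.
      module _ (c+1<q : ℕ.suc c < q) where

        w₀ w₁ w₂ : ℕ
        w₀ = r ℕ.* p ℕ.^ q ∸ r ℕ.^ 2 ℕ.* p ℕ.^ c
        w₁ = r ℕ.* (p ℕ.^ q ∸ p ℕ.^ ℕ.suc c)
        w₂ = r ℕ.* p ℕ.^ q

        private
          x<y : r ℕ.^ 2 ℕ.* p ℕ.^ c < r ℕ.* p ℕ.^ ℕ.suc c
          x<y = begin-strict
            r ℕ.^ 2 ℕ.* p ℕ.^ c         ≡⟨ ℕ.*-assoc r (r ℕ.* 1) (p ℕ.^ c) ⟩
            r ℕ.* (r ℕ.* 1 ℕ.* p ℕ.^ c) <⟨ ℕ.*-monoʳ-< r {{r-nonZero}} (ℕ.*-monoˡ-< (p ℕ.^ c) {{ℕ.>-nonZero (0<p^ c)}}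
                                            (ℕ.≤-<-trans (ℕ.≤-reflexive (ℕ.*-identityʳ r)) (ℕ.∸-monoʳ-< {p} {1} {0} (s≤s z≤n) (ℕ.<⇒≤ 1<p′)))) ⟩
            r ℕ.* (p ℕ.* p ℕ.^ c)       ∎
            where open ℕ.≤-Reasoning

          y<z : r ℕ.* p ℕ.^ ℕ.suc c < w₂
          y<z = ℕ.*-monoʳ-< r {{r-nonZero}} (ℕ.^-monoʳ-< p 1<p′ c+1<q)

          w₁≡ : w₁ ≡ w₂ ∸ r ℕ.* p ℕ.^ ℕ.suc c
          w₁≡ = ℕ.*-distribˡ-∸ r (p ℕ.^ q) (p ℕ.^ ℕ.suc c)

          0<x : 0 < r ℕ.^ 2 ℕ.* p ℕ.^ c
          0<x = ℕ.*-mono-< (ℕ.m^n>0 r {{r-nonZero}} 2) (0<p^ c)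

          w₁<w₀ : w₁ < w₀
          w₁<w₀ = ℕ.≤-<-trans (ℕ.≤-reflexive w₁≡) (ℕ.∸-monoʳ-< x<y (ℕ.<⇒≤ y<z))

          w₀<w₂ : w₀ < w₂
          w₀<w₂ = ℕ.∸-monoʳ-< {w₂} {r ℕ.^ 2 ℕ.* p ℕ.^ c} {0} 0<x (ℕ.<⇒≤ (ℕ.<-trans x<y y<z))

          0<w₁ : 0 < w₁
          0<w₁ = subst (0 <_) (sym w₁≡) (ℕ.m<n⇒0<n∸m y<z)

        to-w₀ : ∀ {w} → w ℕ.+ r ℕ.^ 2 ℕ.* p ℕ.^ c ≡ w₂ → w ≡ w₀
        to-w₀ {w} eq = trans (sym (ℕ.m+n∸n≡m w (r ℕ.^ 2 ℕ.* p ℕ.^ c))) (cong (_∸ r ℕ.^ 2 ℕ.* p ℕ.^ c) eq)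

        to-w₁ : ∀ {w} → w ℕ.+ r ℕ.* p ℕ.^ ℕ.suc c ≡ w₂ → w ≡ w₁
        to-w₁ {w} eq = trans (sym (ℕ.m+n∸n≡m w (r ℕ.* p ℕ.^ ℕ.suc c))) (trans (cong (_∸ r ℕ.* p ℕ.^ ℕ.suc c) eq) (sym w₁≡))

        threeWeights : HasNonzeroWeights (code D₁?) (w₀ ∷ w₁ ∷ w₂ ∷ [])
        threeWeights = hasNonzeroWeights D₁?
          (((ℕ.<⇒≢ w₁<w₀ ∘ sym) ∷ ℕ.<⇒≢ w₀<w₂ ∷ []) ∷ (ℕ.<⇒≢ (ℕ.<-trans w₁<w₀ w₀<w₂) ∷ []) ∷ [] ∷ [])
          ( (ℕ.>⇒≢ (ℕ.<-trans 0<w₁ w₁<w₀) , attained₀)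
          ∷ (ℕ.>⇒≢ 0<w₁ , attained₁)
          ∷ (ℕ.>⇒≢ (ℕ.<-trans 0<w₁ (ℕ.<-trans w₁<w₀ w₀<w₂)) , attained₂) ∷ [])
          complete
          where
          -- The weights are attained at the unit vectors of an element of B, of
          -- the bottom element, and of an upper element outside B.
          attained₀ : ∃ λ u → W u ≡ w₀
          attained₀ = let (j , j∈) = ∃-inside B (subst (1 ≤_) (sym ∣B∣≡) (s≤s z≤n)) in
            basisVector (Fin.suc j) ,
            to-w₀ (weight-0 (basis≢0 (Fin.suc j)) (inj₁ wt-singleton-0)
              (δ-0 (basisVector (Fin.suc j)) λ h → 1#≢0# prime
                (trans (sym (lookup-basisVector-≡ j)) (h (Fin.suc j) (Vec.there (Vec.lookup⇒[]= j B j∈))))))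
          attained₁ : ∃ λ u → W u ≡ w₁
          attained₁ = basisVector Fin.zero ,
            to-w₁ (weight-11 (basis≢0 Fin.zero) (wt-singleton (1#≢0# prime))
              (δ-1 (basisVector Fin.zero) λ { (Fin.suc i) _ → Vec.lookup-replicate i 0# }))
          attained₂ : ∃ λ u → W u ≡ w₂
          attained₂ = let (j , j∉) = ∃-outside B (subst (_< q) (sym ∣B∣≡) c+1<q) in
            basisVector (Fin.suc j) ,
            weight-01 (basis≢0 (Fin.suc j)) wt-singleton-0
              (δ-1 (basisVector (Fin.suc j)) λ { (Fin.suc i) (Vec.there i∈) →
                 lookup-basisVector-≢ {i = i} {j} λ { refl → contradiction (trans (sym (Vec.[]=⇒lookup i∈)) j∉) λ () } })

          complete : ∀ u → W u ≢ 0 → W u ∈ˡ w₀ ∷ w₁ ∷ w₂ ∷ []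
          complete (a ∷ y) w≢0 = classify (iverson-01 (vanishesOn? (shift 1 B) (a ∷ y))) (wt-01 a)
            where
            u≢0 : a ∷ y ≢ 0ᵛ
            u≢0 = wt≢0⇒≢0ᵛ D₁? (a ∷ y) w≢0
            classify : δ (shift 1 B) (a ∷ y) ≡ 0 ⊎ δ (shift 1 B) (a ∷ y) ≡ 1 → wt (a ∷ []) ≡ 0 ⊎ wt (a ∷ []) ≡ 1 →
                       W (a ∷ y) ∈ˡ w₀ ∷ w₁ ∷ w₂ ∷ []
            classify (inj₁ δ≡0) k01        = here (to-w₀ (weight-0 u≢0 k01 δ≡0))
            classify (inj₂ δ≡1) (inj₁ k≡0) = there (there (here (weight-01 u≢0 k≡0 δ≡1)))
            classify (inj₂ δ≡1) (inj₂ k≡1) = there (here (to-w₁ (weight-11 u≢0 k≡1 δ≡1)))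

    threeWeights-∣B∣ : 1 ≤ ∣ B ∣ → ∣ B ∣ ≤ q ∸ 1 → HasNonzeroWeights (code D₁?)
      ( (p ∸ 1) ℕ.* p ℕ.^ q ∸ (p ∸ 1) ℕ.^ 2 ℕ.* p ℕ.^ (∣ B ∣ ∸ 1)
      ∷ (p ∸ 1) ℕ.* (p ℕ.^ q ∸ p ℕ.^ ∣ B ∣)
      ∷ (p ∸ 1) ℕ.* p ℕ.^ q
      ∷ [] )
    threeWeights-∣B∣ 1≤b b≤q-1 = subst
      (λ b → HasNonzeroWeights (code D₁?)
        ( (p ∸ 1) ℕ.* p ℕ.^ q ∸ (p ∸ 1) ℕ.^ 2 ℕ.* p ℕ.^ (∣ B ∣ ∸ 1)
        ∷ (p ∸ 1) ℕ.* (p ℕ.^ q ∸ p ℕ.^ b) ∷ (p ∸ 1) ℕ.* p ℕ.^ q ∷ [] ))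
      (sym ∣B∣≡) (threeWeights ∣B∣≡ (subst (_< q) ∣B∣≡ (b<q q b≤q-1)))
      where
      ∣B∣≡ : ∣ B ∣ ≡ ℕ.suc (∣ B ∣ ∸ 1)
      ∣B∣≡ = sym (ℕ.suc-pred ∣ B ∣ {{ℕ.>-nonZero 1≤b}})
      b<q : ∀ q → ∣ B ∣ ≤ q ∸ 1 → ∣ B ∣ < q
      b<q ℕ.zero    b≤0 = contradiction (ℕ.≤-trans 1≤b b≤0) λ ()
      b<q (ℕ.suc q) b≤q = s≤s b≤q

  -- The degenerate case

  wPart-∷ : ∀ {q} (le : 1 ≤ ℕ.suc q) (a : 𝔽 p) (y : Vec (𝔽 p) q) → wPart le (a ∷ y) ≡ y
  wPart-∷ le a y = Vec.cast-is-id _ y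

  -- Here m = 1 and B is the whole upper level.
  module Degenerate {c : ℕ} (B : Subset (ℕ.suc c)) (∣B∣≡ : ∣ B ∣ ≡ ℕ.suc c) (le : 1 ≤ ℕ.suc (ℕ.suc c)) where

    private
      -- The number of units.
      r : ℕ
      r = p ∸ 1

      V : Set
      V = Vec (𝔽 p) (ℕ.suc (ℕ.suc c))

      e₁ : V
      e₁ = basisVector Fin.zero

    B-full : ∀ j → lookup B j ≡ inside
    B-full j = trans (cong (λ B → lookup B j) (∣p∣≡n⇒p≡⊤ {p = B} ∣B∣≡)) (Vec.lookup-replicate j inside)

    ≢0ᵛ⇒∃ : ∀ {n} (y : Vec (𝔽 p) n) → y ≢ 0ᵛ → ∃ λ j → lookup y j ≢ 0#
    ≢0ᵛ⇒∃ []      y≢0 = contradiction refl y≢0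
    ≢0ᵛ⇒∃ (a ∷ y) y≢0 with a Fin.≟ 0#
    ... | no a≢0   = Fin.zero , a≢0
    ... | yes refl = let (j , yj≢0) = ≢0ᵛ⇒∃ y (y≢0 ∘ cong (0# ∷_)) in Fin.suc j , yj≢0

    D⇒ : ∀ a y → DefiningSet p 1 (shift 1 B) (a ∷ y) → a ≡ 0# × y ≢ 0ᵛ
    D⇒ a y ∉I = a≡0 (a Fin.≟ 0#) , y≢0
      where
      a≡0 : Dec (a ≡ 0#) → a ≡ 0#
      a≡0 (yes eq) = eq
      a≡0 (no a≢0) = contradiction (box⇒ideal 1 B (a ∷ y) (inj₂ high)) ∉I
        where
        high : InBox (highBox 1 B) (a ∷ y)
        high Fin.zero    = a≢0
        high (Fin.suc j) = subst (λ κ → Allowed κ (lookup y j))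
          (sym (trans (Vec.lookup-map j kindOf B) (cong kindOf (B-full j)))) tt
      y≢0 : y ≢ 0ᵛ
      y≢0 refl = ∉I (box⇒ideal 1 B (a ∷ 0ᵛ) (inj₁ low))
        where
        low : InBox (lowBox 1 B) (a ∷ 0ᵛ)
        low Fin.zero    = tt
        low (Fin.suc j) = subst (λ κ → Allowed κ (lookup (0ᵛ {p} {ℕ.suc c}) j))
          (sym (Vec.lookup-replicate j null)) (Vec.lookup-replicate j 0#)

    D⇐ : ∀ y → y ≢ 0ᵛ → DefiningSet p 1 (shift 1 B) (0# ∷ y)
    D⇐ y y≢0 = let (j , yj≢0) = ≢0ᵛ⇒∃ y y≢0 in D⁺ 1 B j yj≢0 (inj₂ (Fin.zero , refl))

    D⇔ : ∀ x → DefiningSet p 1 (shift 1 B) x ⇔ (vPart le x ≡ 0ᵛ × wPart le x ≢ 0ᵛ)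
    D⇔ (a ∷ y) = mk⇔
      (λ Dx → let (a≡0 , y≢0) = D⇒ a y Dx in cong (_∷ []) a≡0 , λ eq → y≢0 (trans (sym (wPart-∷ le a y)) eq))
      (λ (v≡0 , w≢0) → subst (λ a → DefiningSet p 1 (shift 1 B) (a ∷ y)) (sym (Vec.∷-injectiveˡ v≡0))
        (D⇐ y (λ y≡0 → w≢0 (trans (wPart-∷ le a y) y≡0))))

    kernel⇒ : ∀ a y → codeword (D₁? B) (a ∷ y) ≡ 0ᵛ → y ≡ 0ᵛ
    kernel⇒ a y eq = ≡0ᵛ y λ j → trans (sym (∙-basisVector (a ∷ y) (Fin.suc j)))
      (codeword≡0⇒ (D₁? B) (a ∷ y) eq (D⇐ (basisVector j) (basis≢0 j)))

    kernel⇐ : ∀ a → codeword (D₁? B) (a ∷ 0ᵛ) ≡ 0ᵛ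
    kernel⇐ a = codeword≡0⇐ (D₁? B) (a ∷ 0ᵛ) λ { (b ∷ y) Dx → begin
      a *ᶠ b +ᶠ 0ᵛ ∙ y     ≡⟨ cong₂ _+ᶠ_ (trans (cong (a *ᶠ_) (proj₁ (D⇒ b y Dx))) (zeroʳ a)) (∙-0ˡ y) ⟩
      0# +ᶠ 0#             ≡⟨ +-identityʳ 0# ⟩
      0#                   ∎ }
      where open ≡-Reasoning

    *e₁ : ∀ a → a *ᵛ e₁ ≡ a ∷ 0ᵛ
    *e₁ a = cong₂ _∷_ (*-identityʳ a) (*ᵛ-zeroʳ a)

    kernel⇔ : ∀ u → codeword (D₁? B) u ≡ 0ᵛ ⇔ (∃ λ a → u ≡ a *ᵛ e₁)
    kernel⇔ (a ∷ y) = mk⇔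
      (λ eq → a , trans (cong (a ∷_) (kernel⇒ a y eq)) (sym (*e₁ a)))
      (λ (b , eq) → trans (cong (codeword (D₁? B)) (trans eq (*e₁ b))) (kernel⇐ b))

    -- The common weight of the nonzero codewords.
    d : ℕ
    d = r ℕ.* p ℕ.^ c

    size-degenerate : size (D₁? B) ≡ p ℕ.^ ℕ.suc c ∸ 1
    size-degenerate = trans (sym (ℕ.m+n∸n≡m (size (D₁? B)) 1)) (cong (_∸ 1) (ℤ.+-injective (begin
      + size (D₁? B) + 1ℤ                                                     ≡⟨ cong (_+ 1ℤ) (size-D₁ B) ⟩
      P ^ ℕ.suc (ℕ.suc c) - (P - 1ℤ) * P ^ ∣ B ∣ - 1ℤ + 1ℤ                    ≡⟨ cong (λ b → P ^ ℕ.suc (ℕ.suc c) - (P - 1ℤ) * P ^ b - 1ℤ + 1ℤ) ∣B∣≡ ⟩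
      P ^ ℕ.suc (ℕ.suc c) - (P - 1ℤ) * P ^ ℕ.suc c - 1ℤ + 1ℤ                  ≡⟨ lemma P (P ^ ℕ.suc c) ⟩
      P ^ ℕ.suc c                                                             ≡⟨ pos-^ p (ℕ.suc c) ⟨
      + (p ℕ.^ ℕ.suc c)                                                       ∎)))
      where
      open ≡-Reasoning
      lemma : ∀ P Q → P * Q - (P - 1ℤ) * Q - 1ℤ + 1ℤ ≡ Q
      lemma = solve-∀

    weight-degenerate : ∀ a y → y ≢ 0ᵛ → W B (a ∷ y) ≡ d
    weight-degenerate a y y≢0 = ℕ.+-cancelʳ-≡ (r ℕ.^ 2 ℕ.* p ℕ.^ c) _ _
      (trans (weight-0 B ∣B∣≡ (y≢0 ∘ Vec.∷-injectiveʳ) (wt-01 a) (δ-0 B (a ∷ y) nonvanishing)) split-p)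
      where
      nonvanishing : ¬ VanishesOn (shift 1 B) (a ∷ y)
      nonvanishing h = let (j , yj≢0) = ≢0ᵛ⇒∃ y y≢0 in
        yj≢0 (h (Fin.suc j) (Vec.there (Vec.lookup⇒[]= j B (B-full j))))
      split-p : r ℕ.* p ℕ.^ ℕ.suc c ≡ d ℕ.+ r ℕ.^ 2 ℕ.* p ℕ.^ c
      split-p = begin
        r ℕ.* (p ℕ.* p ℕ.^ c)                        ≡⟨ cong (λ s → r ℕ.* (s ℕ.* p ℕ.^ c)) (ℕ.suc-pred p) ⟨
        r ℕ.* (p ℕ.^ c ℕ.+ r ℕ.* p ℕ.^ c)            ≡⟨ ℕ.*-distribˡ-+ r (p ℕ.^ c) _ ⟩
        d ℕ.+ r ℕ.* (r ℕ.* p ℕ.^ c)                  ≡⟨ cong (d ℕ.+_) (ℕ.*-assoc r r (p ℕ.^ c)) ⟨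
        d ℕ.+ r ℕ.* r ℕ.* p ℕ.^ c                    ≡⟨ cong (λ s → d ℕ.+ r ℕ.* s ℕ.* p ℕ.^ c) (ℕ.*-identityʳ r) ⟨
        d ℕ.+ r ℕ.^ 2 ℕ.* p ℕ.^ c                    ∎
        where open ≡-Reasoning

    d≢0 : d ≢ 0
    d≢0 = ℕ.>⇒≢ (ℕ.*-mono-< (ℕ.m<n⇒0<n∸m (1<p prime)) (ℕ.m^n>0 p c))

    oneWeight : ∀ u → W B u ≢ 0 → W B u ≡ d
    oneWeight (a ∷ y) w≢0 = weight-degenerate a y λ { refl →
      w≢0 (trans (cong wt (kernel⇐ a)) (wt-0ᵛ (size (D₁? B)))) }

    attained : ∃ λ u → W B u ≡ d
    attained = 0# ∷ basisVector Fin.zero , weight-degenerate 0# (basisVector Fin.zero) (basis≢0 Fin.zero)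

    isOneWeight : Is 1 -Weight (code (D₁? B))
    isOneWeight = d ∷ [] , refl , hasNonzeroWeights (D₁? B) ([] ∷ [])
      ((d≢0 , attained) ∷ []) (λ u w≢0 → here (oneWeight u w≢0))

    -- The first coordinate of a message does not affect the codeword, and the
    -- code is parametrised injectively by the others.
    parameters : code (D₁? B) Is[ p ℕ.^ ℕ.suc c ∸ 1 , ℕ.suc c , d ]
    parameters = record
      { hasLength          = size-degenerate
      ; hasDimension       = image-hasDimension (∘-isLinearMap (codeword-isLinearMap (D₁? B)) 0∷-isLinearMap)
          (λ y → 0# ∷ y , refl) preimage (λ y → kernel⇒ 0# y)
      ; hasMinimumDistance = oneWeight-minimumDistance (D₁? B) d≢0 attained oneWeight }
      where
      open IsLinearMap (codeword-isLinearMap (D₁? B))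
      preimage : ∀ {x} → code (D₁? B) x → ∃ λ y → x ≡ codeword (D₁? B) (0# ∷ y)
      preimage ((a ∷ y) , refl) = y , (begin
        codeword (D₁? B) (a ∷ y)
          ≡⟨ cong (codeword (D₁? B)) (cong₂ _∷_ (+-identityʳ a) (+ᵛ-identityˡ y)) ⟨
        codeword (D₁? B) ((a ∷ 0ᵛ) +ᵛ (0# ∷ y))
          ≡⟨ +-homo (a ∷ 0ᵛ) (0# ∷ y) ⟩
        codeword (D₁? B) (a ∷ 0ᵛ) +ᵛ codeword (D₁? B) (0# ∷ y)
          ≡⟨ cong (_+ᵛ codeword (D₁? B) (0# ∷ y)) (kernel⇐ a) ⟩
        0ᵛ +ᵛ codeword (D₁? B) (0# ∷ y)
          ≡⟨ +ᵛ-identityˡ _ ⟩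
        codeword (D₁? B) (0# ∷ y) ∎)
        where open ≡-Reasoning

  -- Outside the degenerate case some upper index j can serve as the common
  -- index of the spanning set: one not in B if m = 1, any one otherwise.
  nondegenerate : ∀ m {c} (B : Subset (ℕ.suc c)) → 1 ≤ m → ¬ (m ≡ 1 × ∣ B ∣ ≡ ℕ.suc c) →
                  ∃ λ j → lookup B j ≡ outside ⊎ 2 ≤ m
  nondegenerate m B 1≤m h with m ℕ.≟ 1
  ... | yes m≡1 = let (j , eq) = ∃-outside B (ℕ.≤∧≢⇒< (∣p∣≤n B) (λ eq → h (m≡1 , eq))) in j , inj₁ eq
  ... | no  m≢1 = Fin.zero , inj₂ (ℕ.≤∧≢⇒< 1≤m (m≢1 ∘ sym))

-- Reduction to a subset of the upper level

⊆∁initial⇒outside : ∀ m {q} (B₁ : Subset m) (B₂ : Subset q) → (B₁ ++ B₂) ⊆ ∁ (initial m) → B₁ ≡ replicate m outside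
⊆∁initial⇒outside ℕ.zero    []            B₂ sub = refl
⊆∁initial⇒outside (ℕ.suc m) (inside ∷ B₁) B₂ sub with () ← sub Vec.here
⊆∁initial⇒outside (ℕ.suc m) (outside ∷ B₁) B₂ sub = cong (outside ∷_)
  (⊆∁initial⇒outside m B₁ B₂ (λ {i} i∈ → drop-there (sub (Vec.there i∈))))

∣shift∣ : ∀ m {q} (B : Subset q) → ∣ shift m B ∣ ≡ ∣ B ∣
∣shift∣ ℕ.zero    B = refl
∣shift∣ (ℕ.suc m) B = ∣shift∣ m B

-- To prove a statement about all subsets B of the upper level, it suffices
-- to treat n = m + q with q positive and B given by its upper part.
reduction : ∀ {m} (Q : ∀ n → m < n → Subset n → ℕ → Set) →
  (∀ {c} → 1 ≤ m → (m<n : m < m ℕ.+ ℕ.suc c) (B : Subset (ℕ.suc c)) → 1 ≤ ∣ B ∣ → Q (m ℕ.+ ℕ.suc c) m<n (shift m B) ∣ B ∣) →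
  ∀ n → 1 ≤ m → (m<n : m < n) (B : Subset n) → B ⊆ ∁ (initial m) → ∀ b → ∣ B ∣ ≡ b → 1 ≤ b → Q n m<n B b
reduction {m} Q h n 1≤m m<n B B⊆ b ∣B∣≡b 1≤b with ℕ.m≤n⇒∃[o]m+o≡n (<⇒≤ m<n)
... | ℕ.zero  , refl = contradiction m<n (ℕ.<-irrefl (sym (ℕ.+-identityʳ m)))
... | ℕ.suc c , refl with Vec.splitAt m B
... | B₁ , B₂ , refl with ⊆∁initial⇒outside m B₁ B₂ B⊆
... | refl with trans (sym (∣shift∣ m B₂)) ∣B∣≡b
... | refl = h 1≤m m<n B₂ 1≤b

theorem4p7 :
  (p : ℕ) .{{_ : NonZero p}} → Prime p → ¬ (2 ∣ p) →
  (m n : ℕ) → 1 ≤ m → (m<n : m < n) →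
  (B : Subset n) → B ⊆ ∁ (initial m) →
  (b : ℕ) → ∣ B ∣ ≡ b → 1 ≤ b →
  let D? = definingSet? p m B
      P  = + p
      v : Vec (𝔽 p) n → Vec (𝔽 p) m
      v  = vPart (<⇒≤ m<n)
      w : Vec (𝔽 p) n → Vec (𝔽 p) (n ∸ m)
      w  = wPart (<⇒≤ m<n)
      e₁ : Vec (𝔽 p) n
      e₁ = basisVector (fromℕ< (≤-<-trans z≤n m<n))
      c₁ = P ^ (n ∸ m ∸ b)
      c₀ = P ^ (n ∸ m) - P ^ (n ∸ m ∸ b)
      T : ℕ → ℤ
      T k = -1ℤ ^ k * (P - 1ℤ) ^ (m ∸ k)
      countOf : ℕ → ℕ → ℕ
      countOf k d = size (λ (u : Vec (𝔽 p) n) →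
        ¬? (u ≟ᵛ 0ᵛ) ×-dec (wt (v u) ℕ.≟ k) ×-dec (δ B u ℕ.≟ d))
  in
  (¬ (m ≡ 1 × b ≡ n ∸ 1) →
    (+ size D? ≡ P ^ n - P ^ m - (P - 1ℤ) ^ m * (P ^ b - 1ℤ))
    × HasDimension (code D?) n
    × (∀ (u : Vec (𝔽 p) n) → u ≢ 0ᵛ →
        let k = wt (v u) in
        + wt (codeword D? u) ℚ./ 1
          ≡ ((P - 1ℤ) ℚ./ p)
            ℚ.* ((+ size D? + P ^ m * + iverson (k ℕ.≟ 0) + T k * (P ^ b * + δ B u - 1ℤ)) ℚ./ 1))
    × (∀ k → k ≤ m →
        (+ countOf k 0 ≡ + (m C k) * (P - 1ℤ) ^ k * c₀)
        × (+ countOf k 1 ≡ + (m C k) * (P - 1ℤ) ^ k * c₁ - + iverson (k ℕ.≟ 0)))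
    × (∃ λ s → s ≤ 2 ℕ.* (m ℕ.+ 1) × Is s -Weight (code D?))
    × (m ≡ 1 → b ≤ n ∸ 2 →
        (+ size D? ≡ P ^ n - (P - 1ℤ) * P ^ b - 1ℤ)
        × Is 3 -Weight (code D?)
        -- No subtraction truncates: 1 ≤ b ≤ n - 2.
        × HasNonzeroWeights (code D?)
            ( (p ∸ 1) ℕ.* p ℕ.^ (n ∸ 1) ∸ (p ∸ 1) ℕ.^ 2 ℕ.* p ℕ.^ (b ∸ 1)
            ∷ (p ∸ 1) ℕ.* (p ℕ.^ (n ∸ 1) ∸ p ℕ.^ b)
            ∷ (p ∸ 1) ℕ.* p ℕ.^ (n ∸ 1)
            ∷ [] )))
  × (m ≡ 1 → b ≡ n ∸ 1 →
      (∀ x → DefiningSet p m B x ⇔ (v x ≡ 0ᵛ × w x ≢ 0ᵛ))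
      × (∀ u → codeword D? u ≡ 0ᵛ ⇔ (∃ λ a → u ≡ a *ᵛ e₁))
      × Is 1 -Weight (code D?)
      × code D? Is[ p ℕ.^ (n ∸ 1) ∸ 1 , n ∸ 1 , (p ∸ 1) ℕ.* p ℕ.^ (n ∸ 2) ])
-- The omitted argument of `reduction` is the conclusion as a predicate of n,
-- m < n, B and b, which unification finds.
theorem4p7 p pr _ m = reduction _ λ 1≤m m<n B 1≤b → let open Main p pr in
  (λ nd → let (j , spans) = nondegenerate m B 1≤m (λ (m≡1 , eq) →
                              nd (m≡1 , subst (λ m → ∣ B ∣ ≡ m ℕ.+ _ ∸ 1) (sym m≡1) eq)) in
      Boxes.size-D p m B
    , Linear.code-hasDimension p m B pr 1≤m j spans
    , weight-formula-ℚ m B (<⇒≤ m<n)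
    , (λ k _ → counts m B (<⇒≤ m<n) k)
    , fewWeights-D m B
    , λ { refl b≤n-2 → let three = threeWeights-∣B∣ B 1≤b b≤n-2 in
          size-D₁ B , (_ , refl , three) , three })
  , λ { refl b≡n-1 → let open Degenerate B b≡n-1 (<⇒≤ m<n) in
          D⇔ , kernel⇔ , isOneWeight , parameters }
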